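{- Let $\mathcal{T}$ be any non-trivial logical theory, i.e. one that can generate some conflict. Then the following problem is undecidable: given a finite set $\Sigma$ of preference rules from the language $\mathcal{PL}_{\mathsf{DL}}$, decide whether $\Sigma$ is $\mathcal{T}$-acyclic.
   Context: **Knowledge bases.** Fix disjoint sets of predicates $\mathbf{P}$ (each with an arity $\ge 1$; $\mathbf{P}_n$ is the set of $n$-ary ones), constants $\mathbf{C}$ and variables $\mathbf{V}$. These vocabularies are infinite and sufficiently rich (in particular there are infinitely many metadata predicates, see below, of every arity). A dataset is a finite set of facts $P(c_1,\dots,c_n)$ with $P\in\mathbf{P}_n$, $c_i\in\mathbf{C}$. A logical theory $\mathcal{T}$ is a finite set of first-order sentences over $\mathbf{P},\mathbf{C},\mathbf{V}$. A knowledge base (KB) is a pair $\mathcal{K}=(\mathcal{D},\mathcal{T})$ of a dataset and a theory; it is inconsistent, $\mathcal{K}\models\bot$, if $\mathcal{D}\cup\mathcal{T}$ has no model. A conflict of $\mathcal{K}$ is an inclusion-minimal $\mathcal{D}'\subseteq\mathcal{D}$ with $(\mathcal{D}',\mathcal{T})\models\bot$; $\mathrm{Conf}(\mathcal{K})$ is the set of conflicts. $\mathcal{T}$ is non-trivial if there is a dataset $\mathcal{D}$ such that $(\mathcal{D},\mathcal{T})$ has a (nonempty) conflict. **Meta-databases.** Fix $\mathbf{P}_{\mathbf{M}}\subsetneq\mathbf{P}$ (metadata predicates) and $\mathbf{C}_{\mathbf{ID}}\subsetneq\mathbf{C}$ (fact identifiers), assumed distinct from the predicates and constants used in the considered dataset.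 Each $n$-ary $P\in\mathbf{P}_{\mathbf{M}}$ has an associated set of $\mathbf{C}_{\mathbf{ID}}$-positions $\mathsf{pos}_{\mathbf{ID}}(P)\subseteq\{1,\dots,n\}$. A meta-database for $\mathcal{K}=(\mathcal{D},\mathcal{T})$ is a pair $\mathcal{M}=(\mathbf{id},\mathcal{F})$ with $\mathbf{id}:\mathcal{D}\to\mathbf{C}_{\mathbf{ID}}$ injective and $\mathcal{F}$ a dataset over predicates from $\mathbf{P}_{\mathbf{M}}$ such that (i) if $P(c_1,\dots,c_n)\in\mathcal{F}$ then $c_j\in\mathbf{C}_{\mathbf{ID}}$ iff $j\in\mathsf{pos}_{\mathbf{ID}}(P)$, and (ii) every constant of $\mathbf{C}_{\mathbf{ID}}$ occurring in $\mathcal{F}$ equals $\mathbf{id}(\alpha)$ for some $\alpha\in\mathcal{D}$. **Preference rules.** A preference rule has the form $\mathsf{Cond}(x_1,x_2)\rightarrow\mathsf{pref}(x_1,x_2)$, where $\mathsf{pref}$ is a special predicate not occurring in rule bodies, KBs or meta-databases, and the distinguished free variables $x_1,x_2$ occur in the body $\mathsf{Cond}(x_1,x_2)$ only in $\mathbf{C}_{\mathbf{ID}}$-positions of relational atoms over metadata predicates or in equality atoms of the form $x_i=\mathbf{id}(P(\vec t))$. **The language $\mathcal{PL}_{\mathsf{DL}}$.** It consists of the preference rules whose bodies have the form $\varphi_{\mathsf{ont}}\wedge\varphi_{\mathsf{pos}}\wedge\varphi_{\mathsf{fo}}$ where: $\varphi_{\mathsf{ont}}$ is of the form $X_1\sqsubseteq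 P_1\wedge\dots\wedge X_k\sqsubseteq P_k$ with $X_i\in\mathbf{V}$, $P_i\in\mathbf{P}\setminus\mathbf{P}_{\mathbf{M}}$; $\varphi_{\mathsf{pos}}$ is built from atomic statements using $\wedge$ and $\exists$; $\varphi_{\mathsf{fo}}$ is built from atomic statements using $\wedge,\neg,\exists$; and all free variables appear in $\varphi_{\mathsf{pos}}$. Atomic statements are: relational atoms $P(t_1,\dots,t_n)$ with $t_i\in\mathbf{V}\cup\mathbf{C}$ and $P\in\mathbf{P}_n\cup\{X_1,\dots,X_k\}$; atoms $x=\mathbf{id}(P(t_1,\dots,t_n))$ with $x\in\mathbf{V}$, $t_i\in\mathbf{V}\cup\mathbf{C}$, $P\in(\mathbf{P}_n\setminus\mathbf{P}_{\mathbf{M}})\cup\{X_1,\dots,X_k\}$; inequality atoms $x\neq t$ with $x\in\mathbf{V}$, $t\in\mathbf{V}\cup\mathbf{C}$. **Semantics.** For identifiers $id_1,id_2$ of facts of $\mathcal{D}$, $(\mathcal{K},\mathcal{M})\models\mathsf{Cond}(id_1,id_2)$ iff there is a function $\nu$ mapping each free variable of the body to an element of $\mathbf{C}\cup\mathbf{P}$ with $\nu(x_1)=id_1$, $\nu(x_2)=id_2$ such that $f(\nu(\mathsf{Cond}(x_1,x_2)))$ is true, where $\nu(\cdot)$ replaces every free variable by its image, and $f$ is defined recursively: $f$ commutes with $\wedge$ and $\neg$; $f(\exists z\,\phi)$ is true iff $f(\phi[z/c])$ is true for some $c\in\mathbf{C}$; for a predicate $P$ occurring in $\mathcal{F}$,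 $f(P(\vec c))$ is true iff $P(\vec c)\in\mathcal{F}$; for a predicate $P$ occurring in $\mathcal{K}$, $f(P(\vec c))$ is true iff $P(\vec c)\in\mathcal{D}$; $f(id=\mathbf{id}(P(\vec c)))$ is true iff $P(\vec c)\in\mathcal{D}$ and $id=\mathbf{id}(P(\vec c))$; for constants $c,d$, $f(c\neq d)$ is true iff $c\neq d$; $f(A\sqsubseteq B)$ is true iff $\mathcal{T}\models A\sqsubseteq B$ (inclusion of $A$ in $B$); all other atoms are false. For a set $\Sigma$ of rules, $\Sigma(\mathcal{K},\mathcal{M})$ is the set of all $\mathsf{pref}(id_1,id_2)$ such that some rule of $\Sigma$ with body $\mathsf{Cond}$ satisfies $(\mathcal{K},\mathcal{M})\models\mathsf{Cond}(id_1,id_2)$. **$\mathcal{T}$-acyclicity.** For $\alpha,\beta\in\mathcal{D}$, set $\alpha\succ_{\Sigma,\mathcal{K},\mathcal{M}}\beta$ iff $\mathsf{pref}(\mathbf{id}(\alpha),\mathbf{id}(\beta))\in\Sigma(\mathcal{K},\mathcal{M})$ and $\{\alpha,\beta\}\subseteq\mathcal{C}$ for some $\mathcal{C}\in\mathrm{Conf}(\mathcal{K})$. $\Sigma$ is $\mathcal{T}$-acyclic if for every dataset $\mathcal{D}$ and every meta-database $\mathcal{M}$ for $\mathcal{K}=(\mathcal{D},\mathcal{T})$, the relation $\succ_{\Sigma,\mathcal{K},\mathcal{M}}$ is acyclic (there are no $\alpha_1,\dots,\alpha_k$, $k\ge1$, with $\alpha_1\succ\alpha_2\succ\dots\succ\alpha_k\succ\alpha_1$).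 -}

module Defs where

open import Data.Bool.Base using (if_then_else_)
open import Data.Empty using (⊥)
open import Data.Fin.Base using (Fin)
open import Data.Fin.Subset using (Subset) renaming (_∈_ to _∈ₛ_)
open import Data.List.Base using (List; []; _∷_; _++_; map)
open import Data.List.Membership.Propositional using (_∈_; _∉_)
open import Data.List.Relation.Binary.Subset.Propositional using (_⊆_)
open import Data.List.Relation.Unary.All using (All)
open import Data.List.Relation.Unary.Any using (Any)
open import Data.Nat.Base using (ℕ; zero; suc; _+_; _≤_; _<_)
open import Data.Nat.Properties using (_≟_)
open import Data.Product.Base using (Σ; ∃; ∃₂; ∃-syntax; Σ-syntax; _×_; _,_; proj₁)
open import Data.Sum.Base using (_⊎_; inj₁; inj₂)
open import Data.Unit.Base using (⊤)
open import Data.Vec.Base as Vec using (Vec; []; _∷_; lookup)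
open import Data.Vec.Relation.Binary.Pointwise.Inductive using (Pointwise)
open import Function.Bundles using (_⇔_)
open import Relation.Binary.Construct.Closure.Transitive using (TransClosure)
open import Relation.Binary.PropositionalEquality.Core using (_≡_; _≢_)
open import Relation.Nullary.Decidable.Core using (does)
open import Relation.Nullary.Negation.Core using (¬_)

data Rec : ℕ → Set where
  zero : Rec 0
  succ : Rec 1
  proj : ∀ {n} → Fin n → Rec n
  comp : ∀ {m n} → Rec m → Vec (Rec n) m → Rec n
  prim : ∀ {n} → Rec n → Rec (2 + n) → Rec (1 + n)
  mu   : ∀ {n} → Rec (1 + n) → Rec n

infix 4 _[_]↦_

-- f [ xs ]↦ y : the partial function f is defined at xs, with value y.
data _[_]↦_ : ∀ {n} → Rec n → Vec ℕ n → ℕ → Set where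
  zero↦  : zero [ [] ]↦ 0
  succ↦  : ∀ {x} → succ [ x ∷ [] ]↦ suc x
  proj↦  : ∀ {n} {i : Fin n} {xs} → proj i [ xs ]↦ lookup xs i
  comp↦  : ∀ {m n} {f : Rec m} {gs : Vec (Rec n) m} {xs ys z} →
           Pointwise (λ g y → g [ xs ]↦ y) gs ys → f [ ys ]↦ z →
           comp f gs [ xs ]↦ z
  prim↦₀ : ∀ {n} {f : Rec n} {g xs y} →
           f [ xs ]↦ y → prim f g [ 0 ∷ xs ]↦ y
  prim↦ₛ : ∀ {n} {f : Rec n} {g xs k r y} →
           prim f g [ k ∷ xs ]↦ r → g [ k ∷ r ∷ xs ]↦ y →
           prim f g [ suc k ∷ xs ]↦ y
  mu↦    : ∀ {n} {f : Rec (1 + n)} {xs y} →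
           (∀ i → i < y → ∃[ v ] f [ i ∷ xs ]↦ suc v) →
           f [ y ∷ xs ]↦ 0 →
           mu f [ xs ]↦ y

-- Nothing is asked of χ on numbers that are not codes of instances.
Decides : ∀ {a ℓ} {I : Set a} → Rec 1 → (I → ℕ) → (I → Set ℓ) → Set _
Decides χ code A = ∀ i → (A i → χ [ code i ∷ [] ]↦ 1)
                       × (¬ A i → χ [ code i ∷ [] ]↦ 0)

Undecidable : ∀ {a ℓ} {I : Set a} → (I → ℕ) → (I → Set ℓ) → Set _
Undecidable code A = ¬ (∃[ χ ] Decides χ code A)

Const Var : Set
Const = ℕ
Var   = ℕ

-- Countably many predicates of each arity ≥ 1, and none of arity 0.
data Pred : ℕ → Set where
  symbol : ∀ {n} → ℕ → Pred (suc n)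

record Fact : Set where
  constructor fact
  field
    {arity} : ℕ
    pred    : Pred arity
    args    : Vec Const arity

-- Finite sets are lists, considered only up to membership.
Dataset : Set
Dataset = List Fact

-- posID is meaningful only on metadata predicates; which positions are
-- identifier positions is left entirely arbitrary.
record MetaVocabulary : Set₁ where
  field
    Meta           : ∀ {n} → Pred n → Set
    IsID           : Const → Set
    posID          : ∀ {n} → Pred n → Subset n
    meta-infinite  : ∀ n b → ∃[ i ] b ≤ i × Meta (symbol {n} i)
    meta-proper    : ∃₂ λ n (P : Pred n) → ¬ Meta P
    id-infinite    : ∀ b → ∃[ c ] b ≤ c × IsID c
    nonid-infinite : ∀ b → ∃[ c ] b ≤ c × ¬ IsID c

data Term : Set where
  var : Var → Term
  con : Const → Term

data Formula : Set where
  rel         : ∀ {n} → Pred n → Vec Term n → Formula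
  _≐_         : Term → Term → Formula
  neg         : Formula → Formula
  _∧′_ _∨′_ _⇒′_ : Formula → Formula → Formula
  all′ ex′    : Var → Formula → Formula

_freeIn_ : Var → Formula → Set
x freeIn rel P ts  = ∃[ j ] lookup ts j ≡ var x
x freeIn (s ≐ t)   = s ≡ var x ⊎ t ≡ var x
x freeIn neg φ     = x freeIn φ
x freeIn (φ ∧′ ψ)  = x freeIn φ ⊎ x freeIn ψ
x freeIn (φ ∨′ ψ)  = x freeIn φ ⊎ x freeIn ψ
x freeIn (φ ⇒′ ψ)  = x freeIn φ ⊎ x freeIn ψ
x freeIn all′ z φ  = x ≢ z × x freeIn φ
x freeIn ex′ z φ   = x ≢ z × x freeIn φ

record Sentence : Set where
  field
    formula : Formula
    closed  : ∀ x → ¬ (x freeIn formula)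

Theory : Set
Theory = List Sentence

record Structure : Set₁ where
  field
    Dom      : Set
    constant : Const → Dom
    relation : ∀ {n} → Pred n → Vec Dom n → Set

_[_↦_] : ∀ {a} {A : Set a} → (Var → A) → Var → A → (Var → A)
(ρ [ z ↦ d ]) y = if does (y ≟ z) then d else ρ y

-- Satisfaction is classical: the double negations on atoms, disjunctions
-- and existentials make every formula ¬¬-stable, and they disappear in the
-- presence of excluded middle.
module _ (S : Structure) where
  open Structure S

  Holds : ∀ {n} → Pred n → Vec Dom n → Set
  Holds P ds = ¬ ¬ relation P ds

  value : (Var → Dom) → Term → Dom
  value ρ (var x) = ρ x
  value ρ (con c) = constant c

  Sat : (Var → Dom) → Formula → Set
  Sat ρ (rel P ts) = Holds P (Vec.map (value ρ) ts)
  Sat ρ (s ≐ t)    = ¬ ¬ (value ρ s ≡ value ρ t)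
  Sat ρ (neg φ)    = ¬ Sat ρ φ
  Sat ρ (φ ∧′ ψ)   = Sat ρ φ × Sat ρ ψ
  Sat ρ (φ ∨′ ψ)   = ¬ ¬ (Sat ρ φ ⊎ Sat ρ ψ)
  Sat ρ (φ ⇒′ ψ)   = Sat ρ φ → Sat ρ ψ
  Sat ρ (all′ z φ) = ∀ d → Sat (ρ [ z ↦ d ]) φ
  Sat ρ (ex′ z φ)  = ¬ ¬ (∃[ d ] Sat (ρ [ z ↦ d ]) φ)

  ModelOfTheory : Theory → Set
  ModelOfTheory T = ∀ {σ} → σ ∈ T → ∀ ρ → Sat ρ (Sentence.formula σ)

  ModelOfData : Dataset → Set
  ModelOfData D = ∀ {α} → α ∈ D →
    Holds (Fact.pred α) (Vec.map constant (Fact.args α))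

Inconsistent : Dataset → Theory → Set₁
Inconsistent D T = ¬ (Σ[ S ∈ Structure ] ModelOfData S D × ModelOfTheory S T)

_⊨_⊑_ : ∀ {n} → Theory → Pred n → Pred n → Set₁
T ⊨ A ⊑ B = ∀ S → ModelOfTheory S T → ∀ ds → Holds S A ds → Holds S B ds

record Conflict (D : Dataset) (T : Theory) (C : Dataset) : Set₁ where
  field
    subset       : C ⊆ D
    inconsistent : Inconsistent C T
    minimal      : ∀ C′ → C′ ⊆ C → Inconsistent C′ T → C ⊆ C′

data Head : ℕ → Set where
  pname : ∀ {n} → Pred n → Head n
  pvar  : ∀ {n} → Var → Head (suc n)

data Atom : Set where
  rel   : ∀ {n} → Head n → Vec Term n → Atom
  _≔id_⟨_⟩ : ∀ {n} → Var → Head n → Vec Term n → Atom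
  _≠_   : Var → Term → Atom

data Body : Set where
  atom  : Atom → Body
  neg   : Body → Body
  _and_ : Body → Body → Body
  ex    : Var → Body → Body

-- The rule  ⋀ X ⊑ P (over ont)  ∧  pos  ∧  fo  →  pref(x₁, x₂).
record Rule : Set where
  field
    x₁ x₂ : Var
    ont   : List (Var × ∃ Pred)
    pos   : Body
    fo    : Body

Positive : Body → Set
Positive (atom a)  = ⊤
Positive (neg φ)   = ⊥
Positive (φ and ψ) = Positive φ × Positive ψ
Positive (ex z φ)  = Positive φ

EveryAtom : (Atom → Set) → Body → Set
EveryAtom A (atom a)  = A a
EveryAtom A (neg φ)   = EveryAtom A φ
EveryAtom A (φ and ψ) = EveryAtom A φ × EveryAtom A ψ
EveryAtom A (ex z φ)  = EveryAtom A φ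

_inTerms_ : ∀ {n} → Var → Vec Term n → Set
x inTerms ts = ∃[ j ] lookup ts j ≡ var x

_inHead_ : ∀ {n} → Var → Head n → Set
x inHead pname P = ⊥
x inHead pvar X = x ≡ X

_inAtom_ : Var → Atom → Set
x inAtom rel H ts       = x inHead H ⊎ x inTerms ts
x inAtom (y ≔id H ⟨ ts ⟩) = x ≡ y ⊎ x inHead H ⊎ x inTerms ts
x inAtom (y ≠ t)        = x ≡ y ⊎ t ≡ var x

_freeInBody_ : Var → Body → Set
x freeInBody atom a    = x inAtom a
x freeInBody neg φ     = x freeInBody φ
x freeInBody (φ and ψ) = x freeInBody φ ⊎ x freeInBody ψ
x freeInBody ex z φ    = x ≢ z × x freeInBody φ

module _ (V : MetaVocabulary) where
  open MetaVocabulary V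

  -- Predicate variables of an atom must be among Xs; the predicate of an
  -- identifier atom must not be a metadata predicate.
  AtomicStatement : List Var → Atom → Set
  AtomicStatement Xs (rel (pname P) ts)        = ⊤
  AtomicStatement Xs (rel (pvar X) ts)        = X ∈ Xs
  AtomicStatement Xs (y ≔id pname P ⟨ ts ⟩)    = ¬ Meta P
  AtomicStatement Xs (y ≔id pvar X ⟨ ts ⟩)    = X ∈ Xs
  AtomicStatement Xs (y ≠ t)                  = ⊤

  -- x occurs only in identifier positions of metadata atoms, or as the
  -- left-hand side of an identifier atom.
  OnlyIdentifier : Var → Atom → Set
  OnlyIdentifier x (rel (pname P) ts)  =
    ∀ j → lookup ts j ≡ var x → Meta P × j ∈ₛ posID P
  OnlyIdentifier x (rel (pvar X) ts)  = x ≢ X × ¬ (x inTerms ts)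
  OnlyIdentifier x (y ≔id H ⟨ ts ⟩)   = ¬ (x inHead H) × ¬ (x inTerms ts)
  OnlyIdentifier x (y ≠ t)            = x ≢ y × t ≢ var x

  record PLDL (r : Rule) : Set where
    open Rule r
    ontVars : List Var
    ontVars = map proj₁ ont
    field
      distinct     : x₁ ≢ x₂
      ont-nonmeta  : All (λ (X , _ , P) → ¬ Meta P) ont
      pos-positive : Positive pos
      pos-atomic   : EveryAtom (AtomicStatement ontVars) pos
      fo-atomic    : EveryAtom (AtomicStatement ontVars) fo
      x₁-free      : x₁ freeInBody pos
      x₂-free      : x₂ freeInBody pos
      ont-free     : ∀ {X} → X ∈ ontVars → X freeInBody pos
      fo-free      : ∀ {x} → x freeInBody fo → x freeInBody pos
      x₁-ont       : x₁ ∉ ontVars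
      x₂-ont       : x₂ ∉ ontVars
      x₁-pos       : EveryAtom (OnlyIdentifier x₁) pos
      x₂-pos       : EveryAtom (OnlyIdentifier x₂) pos
      x₁-fo        : EveryAtom (OnlyIdentifier x₁) fo
      x₂-fo        : EveryAtom (OnlyIdentifier x₂) fo

  RuleSet : Set
  RuleSet = Σ[ rs ∈ List Rule ] All PLDL rs

  -- Datasets of knowledge bases are disjoint from the metadata vocabulary.
  KBData : Dataset → Set
  KBData D = ∀ {α} → α ∈ D →
    ¬ Meta (Fact.pred α) × (∀ j → ¬ IsID (lookup (Fact.args α) j))

  NonTrivial : Theory → Set₁
  NonTrivial T = ∃[ D ] KBData D × (∃[ C ] Conflict D T C × ∃[ α ] α ∈ C)

  -- id is a function on D; its values outside D are never used.
  record MetaDatabase (D : Dataset) : Set where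
    field
      id           : Fact → Const
      id-isID      : ∀ {α} → α ∈ D → IsID (id α)
      id-injective : ∀ {α β} → α ∈ D → β ∈ D → id α ≡ id β → α ≡ β
      facts        : Dataset
      facts-meta   : ∀ {φ} → φ ∈ facts → Meta (Fact.pred φ)
      facts-pos    : ∀ {φ} → φ ∈ facts → ∀ j →
                     IsID (lookup (Fact.args φ) j) ⇔ j ∈ₛ posID (Fact.pred φ)
      facts-id     : ∀ {φ} → φ ∈ facts → ∀ j →
                     IsID (lookup (Fact.args φ) j) →
                     ∃[ α ] α ∈ D × lookup (Fact.args φ) j ≡ id α

  Value : Set
  Value = Const ⊎ ∃ Pred

  -- Substituting ν in an expression is rendered by evaluating it under ν.
  -- Atoms that are ill-formed after substitution (a constant in predicate
  -- position, a predicate in argument position, mismatched arities) are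
  -- false.
  termValue : (Var → Value) → Term → Value
  termValue ν (var x) = ν x
  termValue ν (con c) = inj₁ c

  HeadIs : ∀ {n} → (Var → Value) → Head n → Pred n → Set
  HeadIs     ν (pname Q) P = Q ≡ P
  HeadIs {n} ν (pvar X) P = ν X ≡ inj₂ (n , P)

  Denotes : ∀ {n} → (Var → Value) → Head n → Vec Term n → Fact → Set
  Denotes {n} ν H ts α = Σ[ P ∈ Pred n ] Σ[ cs ∈ Vec Const n ]
    HeadIs ν H P × Vec.map (termValue ν) ts ≡ Vec.map inj₁ cs × α ≡ fact P cs

  module _ {D : Dataset} (T : Theory) (M : MetaDatabase D) where
    open MetaDatabase M

    -- Since facts and D use disjoint predicates, membership in facts ++ D
    -- amounts to membership in the one where the predicate occurs.
    AtomTrue : (Var → Value) → Atom → Set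
    AtomTrue ν (rel H ts)       = ∃[ α ] Denotes ν H ts α × α ∈ facts ++ D
    AtomTrue ν (x ≔id H ⟨ ts ⟩) =
      ∃[ α ] Denotes ν H ts α × α ∈ D × ν x ≡ inj₁ (id α)
    AtomTrue ν (x ≠ t)          =
      ∃₂ λ c d → ν x ≡ inj₁ c × termValue ν t ≡ inj₁ d × c ≢ d

    BodyTrue : (Var → Value) → Body → Set
    BodyTrue ν (atom a)  = AtomTrue ν a
    BodyTrue ν (neg φ)   = ¬ BodyTrue ν φ
    BodyTrue ν (φ and ψ) = BodyTrue ν φ × BodyTrue ν ψ
    BodyTrue ν (ex z φ)  = ∃[ c ] BodyTrue (ν [ z ↦ inj₁ c ]) φ

    OntTrue : (Var → Value) → Var × ∃ Pred → Set₁
    OntTrue ν (X , n , B) = ∃[ A ] ν X ≡ inj₂ (n , A) × T ⊨ A ⊑ B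

    CondTrue : Rule → Const → Const → Set₁
    CondTrue r i j = ∃[ ν ] ν x₁ ≡ inj₁ i × ν x₂ ≡ inj₁ j
                          × All (OntTrue ν) ont × BodyTrue ν pos × BodyTrue ν fo
      where open Rule r

    Preferred : List Rule → Fact → Fact → Set₁
    Preferred rs α β =
      α ∈ D × β ∈ D
      × Any (λ r → CondTrue r (id α) (id β)) rs
      × (∃[ C ] Conflict D T C × α ∈ C × β ∈ C)

  Acyclic : Theory → RuleSet → Set₁
  Acyclic T (rs , _) = ∀ D → KBData D → (M : MetaDatabase D) →
    ∀ α → ¬ TransClosure (Preferred T M rs) α α

triangle : ℕ → ℕ
triangle zero    = 0
triangle (suc n) = suc n + triangle n

-- Cantor's pairing, a bijection ℕ × ℕ → ℕ.
pair : ℕ → ℕ → ℕ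
pair m n = triangle (m + n) + n

codeList : List ℕ → ℕ
codeList []       = 0
codeList (n ∷ ns) = suc (pair n (codeList ns))

codeTerm : Term → ℕ
codeTerm (var x) = pair 0 x
codeTerm (con c) = pair 1 c

codeTerms : ∀ {n} → Vec Term n → ℕ
codeTerms ts = codeList (map codeTerm (Vec.toList ts))

codePred : ∀ {n} → Pred n → ℕ
codePred (symbol {n} i) = pair n i

codeHead : ∀ {n} → Head n → ℕ
codeHead (pname P) = pair 0 (codePred P)
codeHead (pvar X) = pair 1 X

codeAtom : Atom → ℕ
codeAtom (rel H ts)       = pair 0 (pair (codeHead H) (codeTerms ts))
codeAtom (x ≔id H ⟨ ts ⟩) = pair 1 (pair x (pair (codeHead H) (codeTerms ts)))
codeAtom (x ≠ t)          = pair 2 (pair x (codeTerm t))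

codeBody : Body → ℕ
codeBody (atom a)  = pair 0 (codeAtom a)
codeBody (neg φ)   = pair 1 (codeBody φ)
codeBody (φ and ψ) = pair 2 (pair (codeBody φ) (codeBody ψ))
codeBody (ex z φ)  = pair 3 (pair z (codeBody φ))

codeRule : Rule → ℕ
codeRule r = pair x₁ (pair x₂ (pair
  (codeList (map (λ (X , _ , P) → pair X (codePred P)) ont))
  (pair (codeBody pos) (codeBody fo))))
  where open Rule r

codeRuleSet : ∀ {V} → RuleSet V → ℕ
codeRuleSet (rs , _) = codeList (map codeRule rs)

{-# OPTIONS --safe #-}

-- From a unary partial recursive function g and a number n one gets a single
-- rule that prefers a fact α of a conflict to itself exactly when its body, a
-- closed first-order sentence, holds; the sentence has a finite model in some
-- meta-database exactly when g(n) = 0. A decider χ would be refuted by the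
-- function g that swaps the answer of χ on the rule obtained from g and n,
-- where n is the code of the part of that rule that depends on g.
--
-- The sentence speaks about one ternary relation E. One element o is both the
-- number zero and the name of the successor relation, E(o, a, a + 1); one
-- element p names a strict order, E(p, a, b) for a > b; any other element h may
-- name a finite history, E(h, a, b) saying that h takes the value b at a. The
-- histories witness recursions and searches. The order forces the successor
-- relation of a finite structure to be well-founded, so that the outcome of a
-- search is a genuine number.

module Submission where

open import Defs
open import Data.Bool.Base using (Bool; true; false)
open import Data.Fin.Base using (Fin; zero; suc; toℕ; _↑ˡ_; _↑ʳ_)
open import Data.Fin.Patterns using (0F; 1F; 2F; 3F; 4F)
open import Data.Fin.Properties using (toℕ-injective)
open import Data.Fin.Subset using () renaming (_∈_ to _∈ₛ_)
open import Data.List.Base as List using (List; []; _∷_; _++_; length; upTo; allFin; concatMap)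
open import Data.List.Extrema.Nat using (max; xs≤max)
open import Data.List.Membership.Propositional using (_∈_; lose; find)
open import Data.List.Membership.Propositional.Properties
import Data.List.Properties as List using (∷-injective)
open import Data.List.Relation.Unary.All as All using ([]; _∷_)
open import Data.List.Relation.Unary.Any using (here; there; index)
open import Data.List.Relation.Unary.Any.Properties using (lookup-index)
open import Data.Nat.Base using (ℕ; zero; suc; _+_; _≤_; _<_; z≤n; s≤s; s≤s⁻¹)
open import Data.Nat.Properties
open import Data.Product.Base using (∃; ∃-syntax; _×_; _,_; proj₁; proj₂)
open import Data.Product.Function.NonDependent.Propositional using (_×-⇔_)
open import Data.Sum.Base using (_⊎_; inj₁; inj₂)
open import Data.Sum.Properties using (inj₁-injective)
open import Data.Vec.Base as Vec
  using (Vec; []; _∷_; lookup; map; replicate; tabulate; toList) renaming (_++_ to _++ᵥ_)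
open import Data.Vec.Properties
  using ( []=⇒lookup; lookup⇒[]=; lookup-map; lookup-replicate; lookup-++ˡ; lookup-++ʳ
        ; map-∘; map-cong; map-replicate; tabulate-∘; tabulate-cong; tabulate∘lookup
        ; ∷-injectiveˡ; ∷-injectiveʳ; cast-is-id; toList-injective)
open import Data.Vec.Relation.Binary.Pointwise.Inductive using (Pointwise; []; _∷_)
open import Function.Base using (flip; _∘_)
open import Function.Bundles using (_⇔_; mk⇔; module Equivalence)
open import Function.Definitions using (Injective)
open import Function.Properties.Equivalence using () renaming (refl to ⇔-refl; trans to ⇔-trans)
open import Induction.WellFounded using (Acc; acc; WellFounded; module Subrelation)
open import Relation.Binary.Construct.Closure.Transitive using (TransClosure; [_]; _∷_)
open import Relation.Binary.Definitions using (tri<; tri≈; tri>)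
open import Relation.Binary.PropositionalEquality
  using (_≡_; _≢_; refl; sym; trans; cong; cong₂; subst)
open import Relation.Nullary.Decidable using (yes; no; dec-true; dec-false; decidable-stable)
open import Relation.Nullary.Negation.Core using (¬_; contradiction; contraposition)
open Equivalence using (to; from)

-- Partial recursive functions

mutual
  deterministic : ∀ {n} (f : Rec n) {xs y z} → f [ xs ]↦ y → f [ xs ]↦ z → y ≡ z
  deterministic zero     zero↦ zero↦ = refl
  deterministic succ     succ↦ succ↦ = refl
  deterministic (proj i) proj↦ proj↦ = refl
  deterministic (comp f gs) (comp↦ ps p) (comp↦ qs q)
    with refl ← deterministic* gs ps qs = deterministic f p q
  deterministic (prim f g) (prim↦₀ p) (prim↦₀ q) = deterministic f p q
  deterministic (prim f g) (prim↦ₛ p p′) (prim↦ₛ q q′)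
    with refl ← deterministic (prim f g) p q = deterministic g p′ q′
  -- Of two different outcomes, the smaller is a zero of `f` by one derivation and a point where `f`
  -- is positive by the other.
  deterministic (mu f) (mu↦ {y = y} below p) (mu↦ {y = z} below′ q) with <-cmp y z
  ... | tri≈ _ y≡z _ = y≡z
  ... | tri< y<z _ _ with () ← deterministic f p (proj₂ (below′ y y<z))
  ... | tri> _ _ z<y with () ← deterministic f q (proj₂ (below z z<y))

  deterministic* : ∀ {m n} (gs : Vec (Rec n) m) {xs ys zs} →
    Pointwise (λ g y → g [ xs ]↦ y) gs ys →
    Pointwise (λ g y → g [ xs ]↦ y) gs zs → ys ≡ zs
  deterministic* []       []       []       = refl
  deterministic* (g ∷ gs) (p ∷ ps) (q ∷ qs) =
    cong₂ _∷_ (deterministic g p q) (deterministic* gs ps qs)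

Computable : ∀ {n} → (Vec ℕ n → ℕ) → Set
Computable f = ∃[ r ] (∀ xs → r [ xs ]↦ f xs)

constant : ∀ {n} k → Computable {n} (λ _ → k)
constant zero    = comp zero [] , λ _ → comp↦ [] zero↦
constant (suc k) = let r , p = constant k in
  comp succ (r ∷ []) , λ xs → comp↦ (p xs ∷ []) succ↦

component : ∀ {n} (i : Fin n) → Computable (λ xs → lookup xs i)
component i = proj i , λ _ → proj↦

compose₁ : ∀ {n} (h : ℕ → ℕ) {f : Vec ℕ n → ℕ} →
  Computable {1} (λ xs → h (lookup xs zero)) → Computable f →
  Computable (λ xs → h (f xs))
compose₁ _ (rh , ph) (rf , pf) = comp rh (rf ∷ []) , λ xs → comp↦ (pf xs ∷ []) (ph _)

compose₂ : ∀ {n} (h : ℕ → ℕ → ℕ) {f g : Vec ℕ n → ℕ} →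
  Computable {2} (λ xs → h (lookup xs zero) (lookup xs (suc zero))) →
  Computable f → Computable g →
  Computable (λ xs → h (f xs) (g xs))
compose₂ _ (rh , ph) (rf , pf) (rg , pg) =
  comp rh (rf ∷ rg ∷ []) , λ xs → comp↦ (pf xs ∷ pg xs ∷ []) (ph _)

-- The unfolding of `h` is a propositional hypothesis, because functions on abstract codes do not
-- unfold by computation.
recursion : (h : ℕ → ℕ) (step : ℕ → ℕ → ℕ) →
  Computable {2} (λ xs → step (lookup xs zero) (lookup xs (suc zero))) →
  (∀ k → h (suc k) ≡ step k (h k)) → Computable {1} (λ xs → h (lookup xs zero))
recursion h step (rₛ , pₛ) unfold = prim r₀ rₛ , λ { (k ∷ []) → spec k }
  where
  r₀ : Rec 0
  r₀ = proj₁ (constant (h 0))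
  spec : ∀ k → prim r₀ rₛ [ k ∷ [] ]↦ h k
  spec zero    = prim↦₀ (proj₂ (constant (h 0)) [])
  spec (suc k) = prim↦ₛ (spec k) (subst (rₛ [ _ ]↦_) (sym (unfold k)) (pₛ (k ∷ h k ∷ [])))

addition : Computable {2} (λ xs → lookup xs zero + lookup xs (suc zero))
addition = prim (proj zero) (comp succ (proj (suc zero) ∷ [])) ,
  λ { (m ∷ n ∷ []) → spec m n }
  where
  spec : ∀ m n → prim (proj zero) (comp succ (proj (suc zero) ∷ [])) [ m ∷ n ∷ [] ]↦ (m + n)
  spec zero    n = prim↦₀ proj↦
  spec (suc m) n = prim↦ₛ (spec m n) (comp↦ (proj↦ ∷ []) succ↦)

successor : ∀ {n} {f : Vec ℕ n → ℕ} → Computable f → Computable (λ xs → suc (f xs))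
successor (r , p) = comp succ (r ∷ []) , λ xs → comp↦ (p xs ∷ []) succ↦

pairing : ∀ {n} {f g : Vec ℕ n → ℕ} → Computable f → Computable g →
  Computable (λ xs → pair (f xs) (g xs))
pairing f g = compose₂ _+_ addition
  (compose₁ triangle triangle-computable (compose₂ _+_ addition f g)) g
  where
  triangle-computable : Computable {1} (λ xs → triangle (lookup xs zero))
  triangle-computable = recursion triangle (λ k r → suc k + r)
    (compose₂ _+_ addition (successor (component zero)) (component (suc zero))) (λ _ → refl)

-- Congruences of logical equivalence

¬-⇔ : ∀ {a b} {A : Set a} {B : Set b} → A ⇔ B → (¬ A) ⇔ (¬ B)
¬-⇔ e = mk⇔ (contraposition (from e)) (contraposition (to e))

∃-⇔ : ∀ {a b c} {A : Set a} {B : A → Set b} {C : A → Set c} →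
  (∀ x → B x ⇔ C x) → ∃ B ⇔ ∃ C
∃-⇔ e = mk⇔ (λ (x , b) → x , to (e x) b) (λ (x , c) → x , from (e x) c)

≡-⇔ : ∀ {a} {A : Set a} {x x′ y y′ : A} → x ≡ x′ → y ≡ y′ → (x ≡ y) ⇔ (x′ ≡ y′)
≡-⇔ refl refl = ⇔-refl

-- First-order formulas on E

infix  4 _≈_
infix  3 ~_
infixr 2 _&_

data Fm (k : ℕ) : Set where
  tri  : (h x y : Fin k) → Fm k
  _≈_  : (x y : Fin k) → Fm k
  -- A primitive, because its code has to be computable from the number.
  num  : ℕ → (o x : Fin k) → Fm k
  ~_   : Fm k → Fm k
  _&_  : Fm k → Fm k → Fm k
  some : Fm (suc k) → Fm k

somes : ∀ m {k} → Fm (m + k) → Fm k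
somes zero    φ = φ
somes (suc m) φ = somes m (some φ)

mutual
  graph : ∀ {n k} → Rec n → Fin k → Vec (Fin k) n → Fin k → Fm k
  graph zero        o []       y = y ≈ o
  graph succ        o (x ∷ []) y = tri o x y
  graph (proj i)    o xs       y = y ≈ lookup xs i
  graph (comp {m} f gs) o xs   z =
    somes m (graphs gs (m ↑ʳ o) (map (m ↑ʳ_) xs) ys & graph f (m ↑ʳ o) ys (m ↑ʳ z))
    where ys = tabulate (_↑ˡ _)
  -- The history is that of the recursion.
  graph (prim f g) o (x ∷ xs) y = some
    ( tri 0F (1 ↑ʳ x) (1 ↑ʳ y)
    & ~ some (tri 1F (2 ↑ʳ o) 0F & ~ graph f (2 ↑ʳ o) (map (2 ↑ʳ_) xs) 0F)
    & ~ some (some (some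
        ( tri (4 ↑ʳ o) 2F 1F & tri 3F 1F 0F
        & ~ some ( tri 4F 3F 0F
                 & graph g (5 ↑ʳ o) (3F ∷ 0F ∷ map (5 ↑ʳ_) xs) 1F)))))
  -- The history, constantly o, is a set that contains y and is closed under
  -- predecessors at which f does not vanish.
  graph (mu f) o xs y =
    graph f o (y ∷ xs) o
    & some
    ( tri 0F (1 ↑ʳ y) (1 ↑ʳ o)
    & ~ some
        ( tri 1F 0F (2 ↑ʳ o)
        & ~ (0F ≈ 2 ↑ʳ o)
        & ~ some ( tri (3 ↑ʳ o) 0F 1F & tri 2F 0F (3 ↑ʳ o)
                 & some ( graph f (4 ↑ʳ o) (1F ∷ map (4 ↑ʳ_) xs) 0F
                        & ~ (0F ≈ 4 ↑ʳ o)))))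

  graphs : ∀ {m n k} → Vec (Rec n) m → Fin k → Vec (Fin k) n → Vec (Fin k) m → Fm k
  graphs []       o xs []       = o ≈ o
  graphs (g ∷ gs) o xs (y ∷ ys) = graph g o xs y & graphs gs o xs ys

module _ (E : Const → Const → Const → Set) where

  -- A relation rather than a function: in an arbitrary structure an element may stand for several
  -- numbers or for none.
  Numeral : Const → ℕ → Const → Set
  Numeral c₀ zero    c = c ≡ c₀
  Numeral c₀ (suc k) c = ∃[ b ] E c₀ b c × Numeral c₀ k b

  ⟦_⟧ : ∀ {k} → Fm k → Vec Const k → Set
  ⟦ tri h x y ⟧ ρ = E (lookup ρ h) (lookup ρ x) (lookup ρ y)
  ⟦ x ≈ y ⟧     ρ = lookup ρ x ≡ lookup ρ y
  ⟦ num k o x ⟧ ρ = Numeral (lookup ρ o) k (lookup ρ x)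
  ⟦ ~ φ ⟧       ρ = ¬ ⟦ φ ⟧ ρ
  ⟦ φ & ψ ⟧     ρ = ⟦ φ ⟧ ρ × ⟦ ψ ⟧ ρ
  ⟦ some φ ⟧    ρ = ∃[ c ] ⟦ φ ⟧ (c ∷ ρ)

  module _ (c₀ : Const) where

    -- The meaning of graph, free of variables.
    mutual
      Graph : ∀ {n} → Rec n → Vec Const n → Const → Set
      Graph zero       []       d = d ≡ c₀
      Graph succ       (c ∷ []) d = E c₀ c d
      Graph (proj i)   cs       d = d ≡ lookup cs i
      Graph (comp f gs) cs      d = ∃[ ds ] Graphs gs cs ds × Graph f ds d
      Graph (prim f g) (c ∷ cs) d = ∃[ h ] E h c d
        × ¬ (∃[ b ] E h c₀ b × ¬ Graph f cs b)
        × ¬ (∃[ a ] ∃[ a⁺ ] ∃[ b⁺ ] E c₀ a a⁺ × E h a⁺ b⁺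
             × ¬ (∃[ b ] E h a b × Graph g (a ∷ b ∷ cs) b⁺))
      Graph (mu f)     cs       d = Graph f (d ∷ cs) c₀ × ∃[ h ] E h d c₀
        × ¬ (∃[ a⁺ ] E h a⁺ c₀ × a⁺ ≢ c₀
             × ¬ (∃[ a ] E c₀ a a⁺ × E h a c₀
                  × ∃[ b ] Graph f (a ∷ cs) b × b ≢ c₀))

      Graphs : ∀ {m n} → Vec (Rec n) m → Vec Const n → Vec Const m → Set
      Graphs []       cs []       = c₀ ≡ c₀
      Graphs (g ∷ gs) cs (d ∷ ds) = Graph g cs d × Graphs gs cs ds

  ⟦somes⟧ : ∀ m {k} {φ : Fm (m + k)} {ρ : Vec Const k} →
    ⟦ somes m φ ⟧ ρ ⇔ (∃[ ds ] ⟦ φ ⟧ (ds ++ᵥ ρ))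
  ⟦somes⟧ zero    = mk⇔ ([] ,_) λ { ([] , p) → p }
  ⟦somes⟧ (suc m) = ⇔-trans (⟦somes⟧ m)
    (mk⇔ (λ (ds , d , p) → d ∷ ds , p) (λ { (d ∷ ds , p) → ds , d , p }))

  weaken : ∀ {m k n} (ds : Vec Const m) {ρ : Vec Const k} {xs : Vec (Fin k) n} {cs} →
    map (lookup ρ) xs ≡ cs → map (lookup (ds ++ᵥ ρ)) (map (m ↑ʳ_) xs) ≡ cs
  weaken ds {ρ} {xs} p =
    trans (sym (map-∘ _ _ xs)) (trans (map-cong (lookup-++ʳ ds ρ) xs) p)

  module _ {c₀ : Const} where
    mutual
      -- The values of `o`, `xs` and `y` enter through equations, since the values of shifted
      -- variables below binders agree with the old ones only propositionally.
      ⟦graph⟧ : ∀ {n k} (f : Rec n) {ρ : Vec Const k} {o xs y cs d} →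
        lookup ρ o ≡ c₀ → map (lookup ρ) xs ≡ cs → lookup ρ y ≡ d →
        ⟦ graph f o xs y ⟧ ρ ⇔ Graph c₀ f cs d
      ⟦graph⟧ zero {xs = []} refl refl refl = ⇔-refl
      ⟦graph⟧ succ {xs = x ∷ []} refl refl refl = ⇔-refl
      ⟦graph⟧ (proj i) {ρ} {xs = xs} refl refl refl = ≡-⇔ refl (sym (lookup-map i (lookup ρ) xs))
      ⟦graph⟧ (comp {m} f gs) {ρ} {o} {xs} {y} refl refl refl =
        ⇔-trans (⟦somes⟧ m) (∃-⇔ λ ds →
          ⟦graphs⟧ gs (old ds o) (weaken ds refl) (new ds)
          ×-⇔ ⟦graph⟧ f (old ds o) (new ds) (old ds y))
        where
        old : ∀ ds i → lookup (ds ++ᵥ ρ) (m ↑ʳ i) ≡ lookup ρ i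
        old ds = lookup-++ʳ ds ρ
        new : ∀ ds → map (lookup (ds ++ᵥ ρ)) (tabulate (λ i → i ↑ˡ _)) ≡ ds
        new ds = trans (sym (tabulate-∘ _ _))
          (trans (tabulate-cong (lookup-++ˡ ds ρ)) (tabulate∘lookup ds))
      ⟦graph⟧ (prim f g) {ρ} {xs = x ∷ xs} refl refl refl = ∃-⇔ λ h →
        ⇔-refl
        ×-⇔ ¬-⇔ (∃-⇔ λ b → ⇔-refl ×-⇔ ¬-⇔ (⟦graph⟧ f refl (weaken (b ∷ h ∷ []) refl) refl))
        ×-⇔ ¬-⇔ (∃-⇔ λ a → ∃-⇔ λ a⁺ → ∃-⇔ λ b⁺ → ⇔-refl ×-⇔ ⇔-refl
          ×-⇔ ¬-⇔ (∃-⇔ λ b → ⇔-refl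
            ×-⇔ ⟦graph⟧ g refl
              (cong (λ cs → a ∷ b ∷ cs) (weaken (b ∷ b⁺ ∷ a⁺ ∷ a ∷ h ∷ []) refl)) refl))
      ⟦graph⟧ (mu f) {ρ} {xs = xs} refl refl refl =
        ⟦graph⟧ f refl refl refl ×-⇔ ∃-⇔ λ h → ⇔-refl
        ×-⇔ ¬-⇔ (∃-⇔ λ a⁺ → ⇔-refl ×-⇔ ⇔-refl
          ×-⇔ ¬-⇔ (∃-⇔ λ a → ⇔-refl ×-⇔ ⇔-refl
            ×-⇔ ∃-⇔ λ b → ⟦graph⟧ f refl (cong (a ∷_) (weaken (b ∷ a ∷ a⁺ ∷ h ∷ []) refl)) refl
              ×-⇔ ⇔-refl))

      ⟦graphs⟧ : ∀ {m n k} (gs : Vec (Rec n) m) {ρ : Vec Const k} {o xs ys cs ds} →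
        lookup ρ o ≡ c₀ → map (lookup ρ) xs ≡ cs → map (lookup ρ) ys ≡ ds →
        ⟦ graphs gs o xs ys ⟧ ρ ⇔ Graphs c₀ gs cs ds
      ⟦graphs⟧ []       {ys = []}     p q refl = ≡-⇔ p p
      ⟦graphs⟧ (g ∷ gs) {ys = y ∷ ys} p q refl = ⟦graph⟧ g p q refl ×-⇔ ⟦graphs⟧ gs p q refl

-- Soundness

-- Only finitely many elements lie below any `x`, and a descending chain of a strict order never
-- repeats one of them.
bounded⇒wellFounded : (_≻_ : ℕ → ℕ → Set) → (∀ {x} → ¬ x ≻ x) →
  (∀ {x y z} → x ≻ y → y ≻ z → x ≻ z) → ∀ B → (∀ {x y} → x ≻ y → y < B) →
  WellFounded (flip _≻_)
bounded⇒wellFounded _≻_ irrefl transitive B bound x =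
  descent B x λ y x≻y B≤y → contradiction B≤y (<⇒≱ (bound x≻y))
  where
  -- Downward induction on b: only the elements ≥ b below x are assumed accessible.
  descent : ∀ b x → (∀ y → x ≻ y → b ≤ y → Acc (flip _≻_) y) → Acc (flip _≻_) x
  descent zero    x h = acc λ {y} x≻y → h y x≻y z≤n
  descent (suc b) x h = descent b x λ y x≻y b≤y → split x≻y (m≤n⇒m<n∨m≡n b≤y)
    where
    split : ∀ {y} → x ≻ y → b < y ⊎ b ≡ y → Acc (flip _≻_) y
    split x≻y (inj₁ b<y)  = h _ x≻y b<y
    -- The elements `≥ b` below `b` lie below `x` by transitivity and differ from `b` by
    -- irreflexivity, so `h` covers them.
    split x≻b (inj₂ refl) = descent b b λ z b≻z b≤z →
      h z (transitive x≻b b≻z) (≤∧≢⇒< b≤z λ { refl → irrefl b≻z })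

module Soundness {E : Const → Const → Const → Set} {c₀ : Const}
  (no-predecessor : ∀ {c} → ¬ E c₀ c c₀) (wf : WellFounded (E c₀)) where

  Numerals : ∀ {n} → Vec ℕ n → Vec Const n → Set
  Numerals = Pointwise (Numeral E c₀)

  Value-of : ∀ {n} → Rec n → Vec ℕ n → Const → Set
  Value-of f ks d = ∃[ v ] Numeral E c₀ v d × f [ ks ]↦ v

  numeral-zero : ∀ {v} → Numeral E c₀ v c₀ → v ≡ 0
  numeral-zero {zero}  _           = refl
  numeral-zero {suc v} (_ , e , _) = contradiction e no-predecessor

  mutual
    -- A universal statement is expressed as a negated existential and gives up its witnesses only
    -- under a double negation; hence the continuation `κ`. Structural induction on `f` is combined
    -- with recursion on the numeral for `prim` and with well-founded descent for `mu`.
    sound : ∀ {n} (f : Rec n) {ks cs d} → Numerals ks cs → Graph E c₀ f cs d →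
            ¬ ¬ Value-of f ks d
    sound zero     []       refl κ = κ (0 , refl , zero↦)
    sound succ     (n ∷ []) e    κ = κ (_ , (_ , e , n) , succ↦)
    sound (proj i) ns       refl κ = κ (_ , pick i ns , proj↦)
      where
      pick : ∀ {n} (i : Fin n) {ks cs} → Numerals ks cs → Numeral E c₀ (lookup ks i) (lookup cs i)
      pick zero    (n ∷ _)  = n
      pick (suc i) (_ ∷ ns) = pick i ns
    sound (comp f gs) ns (ds , γs , γ) κ =
      sound* gs ns γs λ (vs , nvs , ps) → sound f nvs γ λ (v , nv , p) → κ (v , nv , comp↦ ps p)
    sound (prim f g) {k ∷ ks} (n ∷ ns) (h , e , base , step) = loop k n e
      where
      -- The history may hold several values at one argument. Each of its pairs is justified by some
      -- pair at the predecessor, and the recursion follows those.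
      loop : ∀ k {c d} → Numeral E c₀ k c → E h c d → ¬ ¬ Value-of (prim f g) (k ∷ ks) d
      loop zero    refl        e κ = base (_ , e , λ γ →
        sound f ns γ λ (v , nv , p) → κ (v , nv , prim↦₀ p))
      loop (suc k) (a , s , n) e κ = step (a , _ , _ , s , e , λ (b , e′ , γ) →
        loop k n e′ λ (r , nr , p) →
        sound g (n ∷ nr ∷ ns) γ λ (v , nv , q) → κ (v , nv , prim↦ₛ p q))
    sound (mu f) {ks} {cs} {d} ns (γ , h , e , step) κ = descend (wf d) e λ (k , n , below) →
      sound f (n ∷ ns) γ λ (v , nv , p) →
      κ (k , n , mu↦ below (subst (f [ _ ]↦_) (numeral-zero nv) p))
      where
      Below : ℕ → Set
      Below k = ∀ i → i < k → ∃[ v ] f [ i ∷ ks ]↦ suc v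
      extend : ∀ {k v b} → Below k → b ≢ c₀ → Numeral E c₀ v b → f [ k ∷ ks ]↦ v → Below (suc k)
      extend {v = zero}  below b≢c₀ nv _ = contradiction nv b≢c₀
      extend {v = suc v} below b≢c₀ nv p i i<1+k with m≤n⇒m<n∨m≡n (s≤s⁻¹ i<1+k)
      ... | inj₁ i<k  = below i i<k
      ... | inj₂ refl = v , p
      -- The descent from the outcome `d` through predecessors in the set `h` must stop at `c₀`. The
      -- way back shows that `d` is a numeral and that `f` is positive at all smaller numbers.
      descend : ∀ {c} → Acc (E c₀) c → E h c c₀ → ¬ ¬ (∃[ k ] Numeral E c₀ k c × Below k)
      descend {c} (acc rec) e κ with c ≟ c₀
      ... | yes refl = κ (0 , refl , λ _ ())
      ... | no c≢c₀  = step (c , e , c≢c₀ , λ (a , s , e′ , b , γ , b≢c₀) →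
        descend (rec s) e′ λ (k , n , below) →
        sound f (n ∷ ns) γ λ (v , nv , p) →
        κ (suc k , (a , s , n) , extend below b≢c₀ nv p))

    sound* : ∀ {m n} (gs : Vec (Rec n) m) {ks cs ds} → Numerals ks cs → Graphs E c₀ gs cs ds →
      ¬ ¬ (∃[ vs ] Numerals vs ds × Pointwise (λ g v → g [ ks ]↦ v) gs vs)
    sound* []       {ds = []}    ns _        κ = κ ([] , [] , [])
    sound* (g ∷ gs) {ds = _ ∷ _} ns (γ , γs) κ =
      sound g ns γ λ (v , nv , p) → sound* gs ns γs λ (vs , nvs , ps) →
      κ (v ∷ vs , nv ∷ nvs , p ∷ ps)

-- Completeness

History : Set
History = List (ℕ × ℕ)

module Completeness (e : ℕ → Const) (e-injective : Injective _≡_ _≡_ e) where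

  Encodes : (Const → Const → Set) → (ℕ → ℕ → Set) → Set
  Encodes R S = (∀ {a b} → S a b → R (e a) (e b))
              × (∀ {c d} → R c d → ∃[ a ] ∃[ b ] S a b × c ≡ e a × d ≡ e b)

  Realises : (Const → Const → Const → Set) → History → Set
  Realises E h = ∃[ w ] Encodes (E w) (λ a b → (a , b) ∈ h)

  Successor : ℕ → ℕ → ℕ → Set
  Successor N a b = a < N × b ≡ suc a

  -- `N` only bounds the length of the line from below, so that several such demands can be met at
  -- once.
  record Meets (N : ℕ) (hs : List History) (E : Const → Const → Const → Set) : Set where
    constructor meets
    field
      {size}    : ℕ
      long      : N ≤ size
      line      : Encodes (E (e 0)) (Successor size)
      histories : ∀ {h} → h ∈ hs → Realises E h

  -- Formulas with negation may become false when a structure grows. A formula is therefore shown to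
  -- hold in every structure that meets finitely many demands; demands of different formulas can be
  -- joined, and one model is built at the end.
  Eventually : ((Const → Const → Const → Set) → Set) → Set₁
  Eventually A = ∃[ N ] ∃[ hs ] (∀ {E} → Meets N hs E → A E)

  module _ {A B : (Const → Const → Const → Set) → Set} where

    ev-map : (∀ {E} → A E → B E) → Eventually A → Eventually B
    ev-map f (N , hs , a) = N , hs , f ∘ a

    ev-both : Eventually A → Eventually B → Eventually (λ E → A E × B E)
    ev-both (N , hs , a) (N′ , hs′ , b) = N + N′ , hs ++ hs′ , λ (meets long s r) →
      a (meets (≤-trans (m≤m+n N N′) long) s (r ∘ ∈-++⁺ˡ)) ,
      b (meets (≤-trans (m≤n+m N′ N) long) s (r ∘ ∈-++⁺ʳ hs))

  ev-always : ∀ {A : (Const → Const → Const → Set) → Set} → (∀ {E} → A E) → Eventually A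
  ev-always a = 0 , [] , λ _ → a

  module _ {A : ℕ → (Const → Const → Const → Set) → Set} where

    ev-below : ∀ y → (∀ i → i < y → Eventually (A i)) →
      Eventually (λ E → ∀ {i} → i < y → A i E)
    ev-below zero    _ = ev-always λ ()
    ev-below (suc y) a = ev-map join
      (ev-both (a y ≤-refl) (ev-below y λ i i<y → a i (m<n⇒m<1+n i<y)))
      where
      join : ∀ {E} → A y E × (∀ {i} → i < y → A i E) → ∀ {i} → i < suc y → A i E
      join (p , ps) i<1+y with m≤n⇒m<n∨m≡n (s≤s⁻¹ i<1+y)
      ... | inj₁ i<y  = ps i<y
      ... | inj₂ refl = p

  ev-successor : ∀ k → Eventually (λ E → E (e 0) (e k) (e (suc k)))
  ev-successor k = suc k , [] , λ (meets long (into , _) _) → into (long , refl)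

  ev-line : Eventually (λ E → ∀ {c d} → E (e 0) c d → ∃[ a ] c ≡ e a × d ≡ e (suc a))
  ev-line = 0 , [] , λ (meets _ (_ , out) _) s →
    let a , _ , (_ , b≡1+a) , c≡ , d≡ = out s in a , c≡ , trans d≡ (cong e b≡1+a)

  ev-history : ∀ h → Eventually (λ E → Realises E h)
  ev-history h = 0 , h ∷ [] , λ (meets _ _ r) → r (here refl)

  Complete : ∀ {n} → Rec n → Set₁
  Complete f = ∀ {ks v} → f [ ks ]↦ v → Eventually (λ E → Graph E (e 0) f (map e ks) (e v))

  module _ {n} {f : Rec n} {g : Rec (2 + n)} {ks : Vec ℕ n} where

    Justified : History → ℕ → ℕ → (Const → Const → Const → Set) → Set
    Justified h a b E = a ≡ 0 × Graph E (e 0) f (map e ks) (e b)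
      ⊎ ∃[ a′ ] ∃[ b′ ] a ≡ suc a′ × (a′ , b′) ∈ h
          × Graph E (e 0) g (e a′ ∷ e b′ ∷ map e ks) (e b)

    -- The history is read off the derivation: it lists the intermediate results from `k` down to 0,
    -- and each new pair is justified by the one before it.
    prim-history : Complete f → Complete g → ∀ {k y} → prim f g [ k ∷ ks ]↦ y →
      ∃[ h ] (k , y) ∈ h × Eventually (λ E → ∀ {a b} → (a , b) ∈ h → Justified h a b E)
    prim-history cf cg {y = y} (prim↦₀ p) = (0 , y) ∷ [] , here refl ,
      ev-map (λ { γ (here refl) → inj₁ (refl , γ) }) (cf p)
    prim-history cf cg {suc k} {y} (prim↦ₛ p q) =
      let h , k∈h , ev = prim-history cf cg p in
      (suc k , y) ∷ h , here refl , ev-map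
        (λ { (γ , _) (here refl) → inj₂ (_ , _ , refl , there k∈h , γ)
           ; (_ , j) (there i) → later (j i) })
        (ev-both (cg q) ev)
      where
      later : ∀ {h x a b E} → Justified h a b E → Justified (x ∷ h) a b E
      later (inj₁ base)                  = inj₁ base
      later (inj₂ (a , b , eq , i , γ)) = inj₂ (a , b , eq , there i , γ)

    -- The element `w` names exactly the pairs of `h`, so every pair that the two universal clauses
    -- meet decodes to a justified pair. Injectivity of `e` matches its argument with zero or with
    -- the given successor.
    complete-prim : ∀ {k y h E} → (k , y) ∈ h → Realises E h →
      (∀ {a b} → (a , b) ∈ h → Justified h a b E) →
      (∀ {c d} → E (e 0) c d → ∃[ a ] c ≡ e a × d ≡ e (suc a)) →
      Graph E (e 0) (prim f g) (e k ∷ map e ks) (e y)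
    complete-prim {h = h} {E} i (w , into , out) just line = w , into i ,
      (λ (b , Eb , ¬γ) → let _ , _ , j , 0≡ , b≡ = out Eb in
        ¬γ (subst (Graph E _ f _) (sym b≡) (base (e-injective (sym 0≡)) (just j)))) ,
      λ (a , a⁺ , b⁺ , s , Eb⁺ , ¬γ) →
        let _ , _ , j , a⁺≡ , b⁺≡ = out Eb⁺
            _ , a≡ , a⁺≡′ = line s
        in step a≡ b⁺≡ (e-injective (trans (sym a⁺≡) a⁺≡′)) (just j) ¬γ
      where
      base : ∀ {a b} → a ≡ 0 → Justified h a b E → Graph E (e 0) f (map e ks) (e b)
      base refl (inj₁ (_ , γ)) = γ
      step : ∀ {a a′ b c d} → c ≡ e a′ → d ≡ e b → a ≡ suc a′ → Justified h a b E →
        ¬ ¬ (∃[ b′ ] E w c b′ × Graph E (e 0) g (c ∷ b′ ∷ map e ks) d)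
      step refl refl refl (inj₂ (a′ , b′ , refl , j , γ)) ¬γ = ¬γ (e b′ , into j , γ)

  -- The required set consists of the numbers from 0 to `y` inclusive. Its elements other than 0
  -- have their predecessor in it, at which `f` does not vanish by `below`.
  complete-mu : ∀ {n} {f : Rec (suc n)} {ks y E} →
    Graph E (e 0) f (map e (y ∷ ks)) (e 0) → Realises E (List.map (_, 0) (upTo (suc y))) →
    (∀ {i} → i < y → E (e 0) (e i) (e (suc i))
                     × ∃[ b ] Graph E (e 0) f (map e (i ∷ ks)) b × b ≢ e 0) →
    Graph E (e 0) (mu f) (map e ks) (e y)
  complete-mu {f = f} {ks} {y} {E} γ (w , into , out) below = γ , w , into (member ≤-refl) ,
    λ (a⁺ , Ea⁺ , a⁺≢0 , ¬γ) → let _ , _ , j , a⁺≡ , _ = out Ea⁺ in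
      step a⁺≡ a⁺≢0 (bound j) ¬γ
    where
    member : ∀ {i} → i ≤ y → (i , 0) ∈ List.map (_, 0) (upTo (suc y))
    member i≤y = ∈-map⁺ (_, 0) (∈-upTo⁺ (s≤s i≤y))
    bound : ∀ {a b} → (a , b) ∈ List.map (_, 0) (upTo (suc y)) → a ≤ y
    bound j with _ , i , refl ← ∈-map⁻ (_, 0) j = s≤s⁻¹ (∈-upTo⁻ i)
    step : ∀ {a a⁺} → a⁺ ≡ e a → a⁺ ≢ e 0 → a ≤ y →
      ¬ ¬ (∃[ c ] E (e 0) c a⁺ × E w c (e 0) × ∃[ b ] Graph E (e 0) f (c ∷ map e ks) b × b ≢ e 0)
    step {zero}  refl a⁺≢0 _   _  = a⁺≢0 refl
    step {suc a} refl _    a<y ¬γ =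
      let s , γ = below a<y in ¬γ (e a , s , into (member (<⇒≤ a<y)) , γ)

  mutual
    complete : ∀ {n} (f : Rec n) → Complete f
    complete zero     zero↦ = ev-always refl
    complete succ     succ↦ = ev-successor _
    complete (proj i) (proj↦ {xs = ks}) = ev-always (sym (lookup-map i e ks))
    complete (comp f gs) (comp↦ ps p) =
      ev-map (λ (γs , γ) → _ , γs , γ) (ev-both (complete* gs ps) (complete f p))
    complete (prim f g) {k ∷ ks} p =
      let h , i , just = prim-history (complete f) (complete g) p in
      ev-map (λ (r , j , l) → complete-prim {f = f} {g} i r j l)
        (ev-both (ev-history h) (ev-both just ev-line))
    complete (mu f) {ks} (mu↦ {y = y} below p) =
      ev-map (λ (γ , r , b) → complete-mu {f = f} γ r b)
        (ev-both (complete f p) (ev-both (ev-history (List.map (_, 0) (upTo (suc y))))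
          (ev-below y λ i i<y → let v , q = below i i<y in
            ev-both (ev-successor i)
              (ev-map (λ γ → e (suc v) , γ , λ eq → contradiction (e-injective eq) λ ())
                (complete f q)))))

    complete* : ∀ {m n} (gs : Vec (Rec n) m) {ks vs} → Pointwise (λ g v → g [ ks ]↦ v) gs vs →
      Eventually (λ E → Graphs E (e 0) gs (map e ks) (map e vs))
    complete* []       []       = ev-always refl
    complete* (g ∷ gs) (p ∷ ps) = ev-both (complete g p) (complete* gs ps)

-- Valuations and names of variables

module _ {a} {A : Set a} where
  update-hit : ∀ (ρ : Var → A) z d → (ρ [ z ↦ d ]) z ≡ d
  update-hit ρ z d rewrite dec-true (z ≟ z) refl = refl

  update-miss : ∀ (ρ : Var → A) {y z} d → y ≢ z → (ρ [ z ↦ d ]) y ≡ ρ y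
  update-miss ρ {y} {z} d y≢z rewrite dec-false (y ≟ z) y≢z = refl

-- The de Bruijn level counts the binders outside that of the variable. Unlike the index it is
-- unchanged by further binders, so it can serve as a name.
level : ∀ {k} → Fin k → ℕ
level {suc k} zero    = k
level         (suc i) = level i

level<k : ∀ {k} (i : Fin k) → level i < k
level<k zero    = ≤-refl
level<k (suc i) = m<n⇒m<1+n (level<k i)

-- Compilation into rule bodies

-- E is held by the ternary metadata predicate Q. Its identifier positions are
-- arbitrary, so there an element x is replaced by the identifier of P(x, …, x).
-- Variables 0 and 1 are those of the rule, 2 to 6 are scratch variables of edge
-- (2, 3, 4) and numeral (5, 6), and the variables of formulas start at 7.
module Compile (V : MetaVocabulary) {m} (P : Pred (suc m)) (Q : Pred 3) where
  open MetaVocabulary V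

  isID : Fin 3 → Bool
  isID = lookup (posID Q)

  -- Between plain terms the rule language offers only inequality atoms.
  equal : Var → Var → Body
  equal x y = neg (atom (x ≠ var y))

  link : Bool → Var → Var → Body
  link true  y x = atom (y ≔id pname P ⟨ replicate _ (var x) ⟩)
  link false y x = equal y x

  -- The arguments h, x, y stand for the variables 5 + h, 5 + x, 5 + y.
  edge : (h x y : Var) → Body
  edge h x y = ex 2 (ex 3 (ex 4
    (link (isID 0F) 2 (5 + h) and
    (link (isID 1F) 3 (5 + x) and
    (link (isID 2F) 4 (5 + y) and
    atom (rel (pname Q) (var 2 ∷ var 3 ∷ var 4 ∷ [])))))))

  -- Variable 5 is the k-th successor of 5 + o.
  numeral : ℕ → Var → Body
  numeral zero    o = equal 5 (5 + o)
  numeral (suc k) o = ex 6 (edge o 1 0 and ex 5 (equal 5 6 and numeral k o))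

  compile : ∀ {k} → Fm k → Body
  compile (tri h x y)  = edge (2 + level h) (2 + level x) (2 + level y)
  compile (x ≈ y)      = equal (7 + level x) (7 + level y)
  compile (num k o x)  = ex 5 (equal 5 (7 + level x) and numeral k (2 + level o))
  compile (~ φ)        = neg (compile φ)
  compile (φ & ψ)      = compile φ and compile ψ
  compile {k} (some φ) = ex (7 + k) (compile φ)

  self : Const → Fact
  self c = fact P (replicate _ c)

  module _ {D : Dataset} (T : Theory) (M : MetaDatabase V D) where
    open MetaDatabase M

    Link : Bool → Const → Const → Set
    Link true  c d = self c ∈ D × d ≡ id (self c)
    Link false c d = d ≡ c

    -- This is the relation `E` that a dataset and its meta-database provide to compiled formulas.
    Edge : Const → Const → Const → Set
    Edge h x y = ∃[ a ] ∃[ b ] ∃[ c ]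
      Link (isID 0F) h a × Link (isID 1F) x b
      × Link (isID 2F) y c × fact Q (a ∷ b ∷ c ∷ []) ∈ facts ++ D

    True : (Var → Value V) → Body → Set
    True = BodyTrue V T M

    equal-true : ∀ ν x y {c d} → ν x ≡ inj₁ c → ν y ≡ inj₁ d → True ν (equal x y) ⇔ (c ≡ d)
    equal-true ν x y {c} {d} νx νy = mk⇔
      (λ t → decidable-stable (c ≟ d) λ c≢d → t (c , d , νx , νy , c≢d))
      unequal
      where
      unequal : c ≡ d → ¬ AtomTrue V T M ν (x ≠ var y)
      unequal c≡d (_ , _ , νx′ , νy′ , c≢d) = c≢d
        (trans (inj₁-injective (trans (sym νx′) νx))
          (trans c≡d (inj₁-injective (trans (sym νy) νy′))))

    replicate-injective : ∀ {n c} (cs : Vec Const n) →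
      replicate n (inj₁ {B = ∃ Pred} c) ≡ map inj₁ cs → cs ≡ replicate n c
    replicate-injective []       _  = refl
    replicate-injective (c ∷ cs) eq = cong₂ _∷_ (sym (inj₁-injective (∷-injectiveˡ eq)))
      (replicate-injective cs (∷-injectiveʳ eq))

    self-denoted : ∀ {ν x c α} → ν x ≡ inj₁ c →
      Denotes V ν (pname P) (replicate (suc m) (var x)) α ⇔ (α ≡ self c)
    self-denoted {ν} {x} {c} {α} νx = mk⇔
      (λ { (_ , cs , refl , eq , refl) →
        cong (fact P) (replicate-injective cs (trans (sym values) eq)) })
      λ { refl → P , _ , refl , trans values (sym (map-replicate inj₁ c (suc m))) , refl }
      where
      values : map (termValue V ν) (replicate (suc m) (var x)) ≡ replicate (suc m) (inj₁ c)
      values = trans (map-replicate (termValue V ν) (var x) (suc m)) (cong (replicate (suc m)) νx)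

    link-true : ∀ b {ν x y c d} → ν y ≡ inj₁ d → ν x ≡ inj₁ c →
      True ν (link b y x) ⇔ Link b c d
    link-true false {ν} {x} {y} νy νx = equal-true ν y x νy νx
    link-true true {ν} {x} νy νx = mk⇔
      (λ (α , den , α∈D , y≡) → helper (to (self-denoted νx) den) α∈D (trans (sym νy) y≡))
      λ (α∈D , eq) → _ , from (self-denoted νx) refl , α∈D , trans νy (cong inj₁ eq)
      where
      helper : ∀ {α c d} → α ≡ self c → α ∈ D → inj₁ {B = ∃ Pred} d ≡ inj₁ (id α) →
        self c ∈ D × d ≡ id (self c)
      helper refl α∈D eq = α∈D , inj₁-injective eq

    edge-true : ∀ {ν h x y a b c} →
      ν (5 + h) ≡ inj₁ a → ν (5 + x) ≡ inj₁ b → ν (5 + y) ≡ inj₁ c →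
      True ν (edge h x y) ⇔ Edge a b c
    edge-true νh νx νy = ∃-⇔ λ _ → ∃-⇔ λ _ → ∃-⇔ λ _ →
      link-true _ refl νh ×-⇔ link-true _ refl νx ×-⇔ link-true _ refl νy ×-⇔
      mk⇔ (λ { (_ , (_ , _ ∷ _ ∷ _ ∷ [] , refl , refl , refl) , α∈) → α∈ })
          (λ α∈ → _ , (Q , _ ∷ _ ∷ _ ∷ [] , refl , refl , refl) , α∈)

    mutual
      numeral-true : ∀ k {ν o c₀ c} → ν (7 + o) ≡ inj₁ c₀ → ν 5 ≡ inj₁ c →
        True ν (numeral k (2 + o)) ⇔ Numeral Edge c₀ k c
      numeral-true zero    {ν} {o} νo ν5 = equal-true ν 5 (7 + o) ν5 νo
      numeral-true (suc k) νo ν5 = ∃-⇔ λ b →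
        edge-true νo refl ν5 ×-⇔ copy-true k {x = 6} νo refl λ ()

      -- The value of `x` is moved to variable 5, where `numeral` expects it; as `x` is not 5, it
      -- keeps its value when 5 is rebound.
      copy-true : ∀ k {ν o x c₀ b} → ν (7 + o) ≡ inj₁ c₀ → ν x ≡ inj₁ b → x ≢ 5 →
        True ν (ex 5 (equal 5 x and numeral k (2 + o))) ⇔ Numeral Edge c₀ k b
      copy-true k {ν} {o} {x} {c₀} {b} νo νx x≢5 = mk⇔
        (λ (c , eq , n) → subst (Numeral Edge c₀ k)
          (to (equal-true (ν [ 5 ↦ inj₁ c ]) 5 x refl (kept c)) eq)
          (to (numeral-true k νo refl) n))
        λ n → b , from (equal-true (ν [ 5 ↦ inj₁ b ]) 5 x refl (kept b)) refl ,
          from (numeral-true k νo refl) n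
        where
        kept : ∀ c → (ν [ 5 ↦ inj₁ c ]) x ≡ inj₁ b
        kept c = trans (update-miss ν _ x≢5) νx

    compile-true : ∀ {k} (φ : Fm k) {ν ρ} → (∀ i → ν (7 + level i) ≡ inj₁ (lookup ρ i)) →
      True ν (compile φ) ⇔ ⟦_⟧ Edge φ ρ
    compile-true (tri h x y) νρ = edge-true (νρ h) (νρ x) (νρ y)
    compile-true (x ≈ y) {ν} νρ = equal-true ν (7 + level x) (7 + level y) (νρ x) (νρ y)
    compile-true (num k o x) νρ = copy-true k {x = 7 + level x} (νρ o) (νρ x) λ ()
    compile-true (~ φ)       νρ = ¬-⇔ (compile-true φ νρ)
    compile-true (φ & ψ)     νρ = compile-true φ νρ ×-⇔ compile-true ψ νρ
    compile-true {k} (some φ) {ν} {ρ} νρ = ∃-⇔ λ c → compile-true φ (extended c)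
      where
      extended : ∀ c i → (ν [ 7 + k ↦ inj₁ c ]) (7 + level i) ≡ inj₁ (lookup (c ∷ ρ) i)
      extended c zero    = update-hit ν (7 + k) (inj₁ c)
      extended c (suc i) = trans
        (update-miss ν (inj₁ c) λ eq → <-irrefl (+-cancelˡ-≡ 7 (level i) k eq) (level<k i)) (νρ i)

  module _ {A : Atom → Set}
    (A-relation : A (rel (pname Q) (var 2 ∷ var 3 ∷ var 4 ∷ [])))
    (A-identifier : ∀ y x → A ((2 + y) ≔id pname P ⟨ replicate _ (var (2 + x)) ⟩))
    (A-inequality : ∀ y x → A ((2 + y) ≠ var (2 + x))) where

    link-atoms : ∀ b y x → EveryAtom A (link b (2 + y) (2 + x))
    link-atoms true  = A-identifier
    link-atoms false = A-inequality

    edge-atoms : ∀ h x y → EveryAtom A (edge h x y)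
    edge-atoms h x y =
      link-atoms (isID 0F) 0 (3 + h) , link-atoms (isID 1F) 1 (3 + x) ,
      link-atoms (isID 2F) 2 (3 + y) , A-relation

    numeral-atoms : ∀ k o → EveryAtom A (numeral k o)
    numeral-atoms zero    o = A-inequality 3 (3 + o)
    numeral-atoms (suc k) o = edge-atoms o 1 0 , A-inequality 3 4 , numeral-atoms k o

    -- Compiled formulas have atoms of three shapes only, with variables from 2 on. One induction
    -- thus serves both the syntax of atomic statements and the conditions on the rule variables 0
    -- and 1.
    compile-atoms : ∀ {k} (φ : Fm k) → EveryAtom A (compile φ)
    compile-atoms (tri h x y) = edge-atoms (2 + level h) (2 + level x) (2 + level y)
    compile-atoms (x ≈ y)     = A-inequality (5 + level x) (5 + level y)
    compile-atoms (num k o x) = A-inequality 3 (5 + level x) , numeral-atoms k (2 + level o)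
    compile-atoms (~ φ)       = compile-atoms φ
    compile-atoms (φ & ψ)     = compile-atoms φ , compile-atoms ψ
    compile-atoms (some φ)    = compile-atoms φ

  equal-free : ∀ {z x y} → z freeInBody equal x y → z ≡ x ⊎ z ≡ y
  equal-free (inj₁ z≡x)  = inj₁ z≡x
  equal-free (inj₂ refl) = inj₂ refl

  link-free : ∀ b {z y x} → z freeInBody link b y x → z ≡ y ⊎ z ≡ x
  link-free false {z} {y} {x} = equal-free {z} {y} {x}
  link-free true (inj₁ z≡y)             = inj₁ z≡y
  link-free true {x = x} (inj₂ (inj₂ (j , eq)))
    with refl ← trans (sym (lookup-replicate j (var x))) eq = inj₂ refl

  edge-free : ∀ {z h x y} → z freeInBody edge h x y → z ≡ 5 + h ⊎ z ≡ 5 + x ⊎ z ≡ 5 + y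
  edge-free (z≢2 , z≢3 , z≢4 , inj₁ l) with link-free (isID 0F) l
  ... | inj₁ z≡2 = contradiction z≡2 z≢2
  ... | inj₂ z≡h = inj₁ z≡h
  edge-free (z≢2 , z≢3 , z≢4 , inj₂ (inj₁ l)) with link-free (isID 1F) l
  ... | inj₁ z≡3 = contradiction z≡3 z≢3
  ... | inj₂ z≡x = inj₂ (inj₁ z≡x)
  edge-free (z≢2 , z≢3 , z≢4 , inj₂ (inj₂ (inj₁ l))) with link-free (isID 2F) l
  ... | inj₁ z≡4 = contradiction z≡4 z≢4
  ... | inj₂ z≡y = inj₂ (inj₂ z≡y)
  edge-free (z≢2 , z≢3 , z≢4 , inj₂ (inj₂ (inj₂ (inj₂ (0F , refl))))) = contradiction refl z≢2
  edge-free (z≢2 , z≢3 , z≢4 , inj₂ (inj₂ (inj₂ (inj₂ (1F , refl))))) = contradiction refl z≢3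
  edge-free (z≢2 , z≢3 , z≢4 , inj₂ (inj₂ (inj₂ (inj₂ (2F , refl))))) = contradiction refl z≢4

  numeral-free : ∀ k {z o} → z freeInBody numeral k o → z ≡ 5 ⊎ z ≡ 5 + o
  numeral-free zero    {z} {o} free = equal-free {z} {5} {5 + o} free
  numeral-free (suc k) (z≢6 , inj₁ free) with edge-free free
  ... | inj₁ z≡o        = inj₂ z≡o
  ... | inj₂ (inj₁ z≡6) = contradiction z≡6 z≢6
  ... | inj₂ (inj₂ z≡5) = inj₁ z≡5
  numeral-free (suc k) {z} (z≢6 , inj₂ (z≢5 , inj₁ free)) with equal-free {z} {5} {6} free
  ... | inj₁ z≡5 = inj₁ z≡5
  ... | inj₂ z≡6 = contradiction z≡6 z≢6
  numeral-free (suc k) (z≢6 , inj₂ (z≢5 , inj₂ free)) = numeral-free k free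

  -- The scratch variables are always bound. For `k = 0` no index `i` exists, so a closed formula
  -- compiles to a body without free variables.
  compile-free : ∀ {k} (φ : Fm k) {z} → z freeInBody compile φ → ∃[ i ] z ≡ 7 + level {k} i
  compile-free (tri h x y) free with edge-free free
  ... | inj₁ z≡h        = h , z≡h
  ... | inj₂ (inj₁ z≡x) = x , z≡x
  ... | inj₂ (inj₂ z≡y) = y , z≡y
  compile-free (x ≈ y) {z} free with equal-free {z} {7 + level x} {7 + level y} free
  ... | inj₁ z≡x = x , z≡x
  ... | inj₂ z≡y = y , z≡y
  compile-free (num k o x) {z} (z≢5 , inj₁ free) with equal-free {z} {5} {7 + level x} free
  ... | inj₁ z≡5 = contradiction z≡5 z≢5
  ... | inj₂ z≡x = x , z≡x
  compile-free (num k o x) (z≢5 , inj₂ free) with numeral-free k free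
  ... | inj₁ z≡5 = contradiction z≡5 z≢5
  ... | inj₂ z≡o = o , z≡o
  compile-free (~ φ)    free              = compile-free φ free
  compile-free (φ & ψ)  (inj₁ free)       = compile-free φ free
  compile-free (φ & ψ)  (inj₂ free)       = compile-free ψ free
  compile-free (some φ) (z≢new , free) with compile-free φ free
  ... | zero  , z≡new = contradiction z≡new z≢new
  ... | suc i , z≡i   = i , z≡i

-- The intended model

module _ {p} {A : ℕ → Set p} (infinite : ∀ b → ∃[ c ] b ≤ c × A c) where

  enumerate : ℕ → ℕ
  enumerate zero    = proj₁ (infinite 0)
  enumerate (suc k) = proj₁ (infinite (suc (enumerate k)))

  enumerate-satisfies : ∀ k → A (enumerate k)
  enumerate-satisfies zero    = proj₂ (proj₂ (infinite 0))
  enumerate-satisfies (suc k) = proj₂ (proj₂ (infinite _))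

  enumerate-mono : ∀ {j k} → j < k → enumerate j < enumerate k
  enumerate-mono {j} {suc k} j<1+k with m≤n⇒m<n∨m≡n (s≤s⁻¹ j<1+k)
  ... | inj₁ j<k  = <-trans (enumerate-mono j<k) (proj₁ (proj₂ (infinite _)))
  ... | inj₂ refl = proj₁ (proj₂ (infinite _))

  enumerate-injective : Injective _≡_ _≡_ enumerate
  enumerate-injective {j} {k} eq with <-cmp j k
  ... | tri< j<k _ _ = contradiction (enumerate-mono j<k) (<-irrefl eq)
  ... | tri≈ _ j≡k _ = j≡k
  ... | tri> _ _ k<j = contradiction (enumerate-mono k<j) (<-irrefl (sym eq))

triangle-mono-≤ : ∀ {m n} → m ≤ n → triangle m ≤ triangle n
triangle-mono-≤ z≤n       = z≤n
triangle-mono-≤ (s≤s m≤n) = +-mono-≤ (s≤s m≤n) (triangle-mono-≤ m≤n)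

-- Diagonal `s` occupies the interval from `triangle s` to `triangle s + s`, which ends before
-- `triangle (suc s)`.
pair-mono-< : ∀ m n m′ n′ → m + n < m′ + n′ → pair m n < pair m′ n′
pair-mono-< m n m′ n′ lt = begin-strict
  triangle (m + n) + n           ≤⟨ +-monoʳ-≤ (triangle (m + n)) (m≤n+m n m) ⟩
  triangle (m + n) + (m + n)     ≡⟨ +-comm (triangle (m + n)) (m + n) ⟩
  (m + n) + triangle (m + n)     <⟨ n<1+n _ ⟩
  triangle (suc (m + n))         ≤⟨ triangle-mono-≤ lt ⟩
  triangle (m′ + n′)             ≤⟨ m≤m+n _ n′ ⟩
  triangle (m′ + n′) + n′        ∎
  where open ≤-Reasoning

-- The code determines the diagonal `m + n`, and the offset `n` on that diagonal.
pair-injective : ∀ m n {m′ n′} → pair m n ≡ pair m′ n′ → m ≡ m′ × n ≡ n′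
pair-injective m n {m′} {n′} eq with <-cmp (m + n) (m′ + n′)
... | tri< lt _ _ = contradiction (pair-mono-< m n m′ n′ lt) (<-irrefl eq)
... | tri> _ _ gt = contradiction (pair-mono-< m′ n′ m n gt) (<-irrefl (sym eq))
... | tri≈ _ s _  = +-cancelʳ-≡ n m m′ (trans s (cong (m′ +_) (sym n≡n′))) , n≡n′
  where
  n≡n′ : n ≡ n′
  n≡n′ = +-cancelˡ-≡ (triangle (m + n)) n n′
    (trans eq (cong (λ k → triangle k + n′) (sym s)))

codeList-injective : Injective _≡_ _≡_ codeList
codeList-injective {[]}     {[]}     _  = refl
codeList-injective {m ∷ ms} {n ∷ ns} eq =
  let m≡n , rest = pair-injective m (codeList ms) (suc-injective eq) in
  cong₂ _∷_ m≡n (codeList-injective rest)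

-- Facts are numbered so that distinct facts can be given distinct identifiers.
codeFact : Fact → ℕ
codeFact (fact (symbol {n} i) cs) = codeList (n ∷ i ∷ toList cs)

codeFact-injective : Injective _≡_ _≡_ codeFact
codeFact-injective {fact (symbol _) cs} {fact (symbol _) ds} eq =
  let m≡n , eq′ = List.∷-injective (codeList-injective eq)
      i≡j , eq″ = List.∷-injective eq′ in
  merge cs ds m≡n i≡j eq″
  where
  merge : ∀ {m n i j} (cs : Vec ℕ (suc m)) (ds : Vec ℕ (suc n)) → m ≡ n → i ≡ j →
    toList cs ≡ toList ds → fact (symbol i) cs ≡ fact (symbol j) ds
  merge cs ds refl refl eq =
    cong (fact _) (trans (sym (cast-is-id refl cs)) (toList-injective refl cs ds eq))

-- Each history is tagged with its position in the list, which becomes its name.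
triples : List History → List (ℕ × ℕ × ℕ)
triples hs = concatMap (λ i → List.map (toℕ i ,_) (List.lookup hs i)) (allFin (length hs))

∈-triples⁺ : ∀ hs i {a b} → (a , b) ∈ List.lookup hs i → (toℕ i , a , b) ∈ triples hs
∈-triples⁺ hs i j = ∈-concatMap⁺ _ {xs = allFin (length hs)}
  (lose (∈-allFin i) (∈-map⁺ (toℕ i ,_) j))

∈-triples⁻ : ∀ hs i {a b} → (toℕ i , a , b) ∈ triples hs → (a , b) ∈ List.lookup hs i
∈-triples⁻ hs i t with find (∈-concatMap⁻ _ {xs = allFin (length hs)} t)
... | j , _ , t′ with ∈-map⁻ (toℕ j ,_) t′
... | _ , u , eq with refl ← toℕ-injective {i = i} {j} (cong proj₁ eq)
                 with refl ← cong proj₂ eq = u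

module Model (e : ℕ → Const) (e-injective : Injective _≡_ _≡_ e) where
  open Completeness e e-injective

  Represents : (Const → Const → Const → Set) → List (ℕ × ℕ × ℕ) → Set
  Represents E ts =
      (∀ {i a b} → (i , a , b) ∈ ts → E (e i) (e a) (e b))
    × (∀ {c₁ c₂ c₃} → E c₁ c₂ c₃ →
       ∃[ i ] ∃[ a ] ∃[ b ] (i , a , b) ∈ ts × c₁ ≡ e i × c₂ ≡ e a × c₃ ≡ e b)

  Greater : ℕ → ℕ → ℕ → Set
  Greater N a b = b < a × a ≤ N

  row : ℕ → History
  row a = List.map (a ,_) (upTo a)

  line greater : ℕ → History
  line N    = List.map (λ a → a , suc a) (upTo N)
  greater N = concatMap row (upTo (suc N))

  line-⇔ : ∀ {N a b} → (a , b) ∈ line N ⇔ Successor N a b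
  line-⇔ = mk⇔ (λ i → let _ , j , eq = ∈-map⁻ _ i in unfold j eq)
               (λ { (a<N , refl) → ∈-map⁺ _ (∈-upTo⁺ a<N) })
    where
    unfold : ∀ {N a b c} → c ∈ upTo N → (a , b) ≡ (c , suc c) → Successor N a b
    unfold j refl = ∈-upTo⁻ j , refl

  greater-⇔ : ∀ {N a b} → (a , b) ∈ greater N ⇔ Greater N a b
  greater-⇔ {N} = mk⇔
    (λ i → let _ , j , k = find (∈-concatMap⁻ row {xs = upTo (suc N)} i)
               _ , l , eq = ∈-map⁻ (_ ,_) k in unfold j l eq)
    (λ (b<a , a≤N) → ∈-concatMap⁺ row (lose (∈-upTo⁺ (s≤s a≤N)) (∈-map⁺ (_ ,_) (∈-upTo⁺ b<a))))
    where
    unfold : ∀ {a b c d} → c ∈ upTo (suc N) → d ∈ upTo c → (a , b) ≡ (c , d) → Greater N a b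
    unfold j l refl = ∈-upTo⁻ l , s≤s⁻¹ (∈-upTo⁻ j)

  encodes-⇔ : ∀ {R S S′} → (∀ {a b} → S a b ⇔ S′ a b) → Encodes R S → Encodes R S′
  encodes-⇔ eq (into , out) = (λ s → into (from eq s)) ,
    λ r → let a , b , s , c≡ , d≡ = out r in a , b , to eq s , c≡ , d≡

  represents⇒encodes : ∀ {E} hs → Represents E (triples hs) → ∀ i →
    Encodes (E (e (toℕ i))) (λ a b → (a , b) ∈ List.lookup hs i)
  represents⇒encodes hs (into , out) i = (λ j → into (∈-triples⁺ hs i j)) , λ r →
    let _ , a , b , t , i≡ , c≡ , d≡ = out r in
    a , b , ∈-triples⁻ hs i (subst (λ i → (i , a , b) ∈ triples hs) (sym (e-injective i≡)) t) ,
    c≡ , d≡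

  -- The line takes position 0, so the number zero also names the successor relation. The order
  -- takes position 1 and the demanded histories start at position 2. An element may be both a
  -- number and a name, as these roles belong to different argument places of `E`.
  model : ∀ N hs → ∃[ ts ] (∀ {E} → Represents E ts →
    Meets N hs E × Encodes (E (e 0)) (Successor N) × Encodes (E (e 1)) (Greater N))
  model N hs = triples (line N ∷ greater N ∷ hs) , λ {E} rep →
    let at = represents⇒encodes {E} (line N ∷ greater N ∷ hs) rep
        successor-encoded = encodes-⇔ {E (e 0)} line-⇔ (at 0F) in
    meets ≤-refl successor-encoded
      (λ h∈hs → e (2 + toℕ (index h∈hs)) ,
        subst (λ h → Encodes (E (e (2 + toℕ (index h∈hs)))) (λ a b → (a , b) ∈ h))
          (sym (lookup-index h∈hs)) (at (suc (suc (index h∈hs)))))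
    , successor-encoded , encodes-⇔ {E (e 1)} greater-⇔ (at 1F)

module Intended (V : MetaVocabulary) (T : Theory)
  {m} {P : Pred (suc m)} (P-nonmeta : ¬ MetaVocabulary.Meta V P)
  {Q : Pred 3} (Q-meta : MetaVocabulary.Meta V Q)
  {D₀ : Dataset} (D₀-data : KBData V D₀) (ts : List (ℕ × ℕ × ℕ)) where
  open MetaVocabulary V
  open Compile V P Q

  element : ℕ → Const
  element = enumerate nonid-infinite

  identifier : Fact → Const
  identifier = enumerate id-infinite ∘ codeFact

  element-nonID : ∀ k → ¬ IsID (element k)
  element-nonID = enumerate-satisfies nonid-infinite

  identifier-isID : ∀ α → IsID (identifier α)
  identifier-isID α = enumerate-satisfies id-infinite (codeFact α)

  identifier-injective : Injective _≡_ _≡_ identifier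
  identifier-injective = codeFact-injective ∘ enumerate-injective id-infinite

  self-injective : Injective _≡_ _≡_ self
  self-injective refl = refl

  elements : ℕ × ℕ × ℕ → List ℕ
  elements (i , a , b) = i ∷ a ∷ b ∷ []

  -- Identifiers in a meta-database must belong to facts of the dataset, so every element used in
  -- `ts` receives a fact `self`.
  D : Dataset
  D = D₀ ++ List.map (self ∘ element) (concatMap elements ts)

  D-data : KBData V D
  D-data α∈D with ∈-++⁻ D₀ α∈D
  ... | inj₁ α∈D₀ = D₀-data α∈D₀
  ... | inj₂ α∈   with k , _ , refl ← ∈-map⁻ (self ∘ element) α∈ = P-nonmeta ,
    λ j isID → element-nonID k (subst IsID (lookup-replicate j (element k)) isID)

  self∈D : ∀ {t k} → t ∈ ts → k ∈ elements t → self (element k) ∈ D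
  self∈D t∈ k∈ = ∈-++⁺ʳ D₀ (∈-map⁺ _ (∈-concatMap⁺ elements (lose t∈ k∈)))

  name : Bool → Const → Const
  name true  c = identifier (self c)
  name false c = c

  tuple : ℕ × ℕ × ℕ → Fact
  tuple (i , a , b) = fact Q
    (name (isID 0F) (element i) ∷ name (isID 1F) (element a) ∷ name (isID 2F) (element b) ∷ [])

  name-⇔ : ∀ b k → IsID (name b (element k)) ⇔ b ≡ true
  name-⇔ true  k = mk⇔ (λ _ → refl) λ _ → identifier-isID (self (element k))
  name-⇔ false k = mk⇔ (λ isID → contradiction isID (element-nonID k)) λ ()

  position : ∀ j k → IsID (name (isID j) (element k)) ⇔ j ∈ₛ posID Q
  position j k = mk⇔ (λ p → lookup⇒[]= j (posID Q) (to (name-⇔ (isID j) k) p))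
                     (λ q → from (name-⇔ (isID j) k) ([]=⇒lookup q))

  named : ∀ b {t} k → t ∈ ts → k ∈ elements t → IsID (name b (element k)) →
    ∃[ α ] α ∈ D × name b (element k) ≡ identifier α
  named true  k t∈ k∈ _ = _ , self∈D t∈ k∈ , refl
  named false k _ _ p = contradiction p (element-nonID k)

  M : MetaDatabase V D
  M = record
    { id           = identifier
    ; id-isID      = λ {α} _ → identifier-isID α
    ; id-injective = λ _ _ → identifier-injective
    ; facts        = List.map tuple ts
    ; facts-meta   = meta
    ; facts-pos    = pos
    ; facts-id     = ids
    }
    where
    meta : ∀ {φ} → φ ∈ List.map tuple ts → Meta (Fact.pred φ)
    meta φ∈ with _ , _ , refl ← ∈-map⁻ tuple φ∈ = Q-meta
    pos : ∀ {φ} → φ ∈ List.map tuple ts → ∀ j →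
      IsID (lookup (Fact.args φ) j) ⇔ j ∈ₛ posID (Fact.pred φ)
    pos φ∈ with (i , a , b) , _ , refl ← ∈-map⁻ tuple φ∈ =
      λ { 0F → position 0F i ; 1F → position 1F a ; 2F → position 2F b }
    ids : ∀ {φ} → φ ∈ List.map tuple ts → ∀ j → IsID (lookup (Fact.args φ) j) →
      ∃[ α ] α ∈ D × lookup (Fact.args φ) j ≡ identifier α
    ids φ∈ with (i , a , b) , t∈ , refl ← ∈-map⁻ tuple φ∈ =
      λ { 0F → named (isID 0F) i t∈ (here refl)
        ; 1F → named (isID 1F) a t∈ (there (here refl))
        ; 2F → named (isID 2F) b t∈ (there (there (here refl))) }

  open Model element (enumerate-injective nonid-infinite)

  link⁺ : ∀ b {t k} → t ∈ ts → k ∈ elements t → Link T M b (element k) (name b (element k))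
  link⁺ true  t∈ k∈ = self∈D t∈ k∈ , refl
  link⁺ false _ _   = refl

  link⁻ : ∀ b {c d} k → Link T M b c d → d ≡ name b (element k) → c ≡ element k
  link⁻ true  k (_ , refl) eq = self-injective (identifier-injective eq)
  link⁻ false k refl       eq = eq

  -- A `Q`-fact can be read back because the name at each position determines the element, by
  -- injectivity of identifiers and of `self`.
  edge-represents : Represents (Edge T M) ts
  edge-represents =
    (λ t∈ → _ , _ , _ , link⁺ (isID 0F) t∈ (here refl) , link⁺ (isID 1F) t∈ (there (here refl)) ,
      link⁺ (isID 2F) t∈ (there (there (here refl))) , ∈-++⁺ˡ (∈-map⁺ tuple t∈)) ,
    λ (_ , _ , _ , l₀ , l₁ , l₂ , q) → decode l₀ l₁ l₂ (∈-++⁻ (List.map tuple ts) q)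
    where
    decode : ∀ {c₁ c₂ c₃ d₁ d₂ d₃} →
      Link T M (isID 0F) c₁ d₁ → Link T M (isID 1F) c₂ d₂ → Link T M (isID 2F) c₃ d₃ →
      fact Q (d₁ ∷ d₂ ∷ d₃ ∷ []) ∈ List.map tuple ts ⊎ fact Q (d₁ ∷ d₂ ∷ d₃ ∷ []) ∈ D →
      ∃[ i ] ∃[ a ] ∃[ b ] (i , a , b) ∈ ts × c₁ ≡ element i × c₂ ≡ element a × c₃ ≡ element b
    decode _  _  _  (inj₂ q) = contradiction Q-meta (proj₁ (D-data q))
    decode l₀ l₁ l₂ (inj₁ q) with (i , a , b) , t∈ , refl ← ∈-map⁻ tuple q = i , a , b , t∈ ,
      link⁻ (isID 0F) i l₀ refl , link⁻ (isID 1F) a l₁ refl , link⁻ (isID 2F) b l₂ refl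

-- Codes of rule sets

-- Abstract, because the codes of concrete bodies are too large to be normalised.
abstract
  bodyCode : Body → ℕ
  bodyCode = codeBody

  exCode andCode : ℕ → ℕ → ℕ
  exCode z c  = pair 3 (pair z c)
  andCode b c = pair 2 (pair b c)

  bodyCode-ex : ∀ z φ → bodyCode (ex z φ) ≡ exCode z (bodyCode φ)
  bodyCode-ex z φ = refl

  bodyCode-and : ∀ φ ψ → bodyCode (φ and ψ) ≡ andCode (bodyCode φ) (bodyCode ψ)
  bodyCode-and φ ψ = refl

  exCode-computable : ∀ {n} {f : Vec ℕ n → ℕ} z → Computable f →
    Computable (λ xs → exCode z (f xs))
  exCode-computable z f = pairing (constant 3) (pairing (constant z) f)

  andCode-computable : ∀ {n} {f g : Vec ℕ n → ℕ} → Computable f → Computable g →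
    Computable (λ xs → andCode (f xs) (g xs))
  andCode-computable f g = pairing (constant 2) (pairing f g)

  ruleSetCode : ℕ → ℕ → ℕ → ℕ → ℕ
  ruleSetCode x₁ x₂ p f = suc (pair (pair x₁ (pair x₂ (pair 0 (pair p f)))) 0)

  codeRuleSet-singleton : ∀ V rs r ok → rs ≡ (r ∷ [] , ok) → Rule.ont r ≡ [] → codeRuleSet {V} rs
    ≡ ruleSetCode (Rule.x₁ r) (Rule.x₂ r) (bodyCode (Rule.pos r)) (bodyCode (Rule.fo r))
  codeRuleSet-singleton V rs r ok refl refl = refl

  ruleSetCode-computable : ∀ {n} {f : Vec ℕ n → ℕ} x₁ x₂ p → Computable f →
    Computable (λ xs → ruleSetCode x₁ x₂ p (f xs))
  ruleSetCode-computable x₁ x₂ p f = successor (pairing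
    (pairing (constant x₁) (pairing (constant x₂) (pairing (constant 0) (pairing (constant p) f))))
    (constant 0))

-- Variable 1 is o and variable 0 is p.
axioms : Fm 2
axioms = ~ some (tri 2F 0F 2F)
       & ~ some (tri 1F 0F 0F)
       & ~ some (some (some (tri 3F 2F 1F & tri 3F 1F 0F & ~ tri 3F 2F 0F)))
       & ~ some (some (tri 3F 1F 0F & ~ tri 2F 0F 1F))

-- The value of `g` is required to be `o`, that is, zero. The number `n` occurs only in `num` and
-- `g` only in its graph, so their contributions to the code are separate.
sentence : Rec 1 → ℕ → Fm 0
sentence g n = some (some (axioms & some (num n 2F 0F & graph g 2F (0F ∷ []) 2F)))

-- The rule for a function and a number, and its code

module Reduction (V : MetaVocabulary) {m} (P : Pred (suc m)) (Q : Pred 3)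
  (P-nonmeta : ¬ MetaVocabulary.Meta V P) (args : Vec Const (suc m)) where
  open MetaVocabulary V
  open Compile V P Q

  -- Both rule variables are tied to the identifier of one fact, so the rule can only prefer this
  -- fact to itself.
  position-body : Body
  position-body = atom (0 ≔id pname P ⟨ map con args ⟩) and atom (1 ≔id pname P ⟨ map con args ⟩)

  rule : Rec 1 → ℕ → Rule
  rule g n = record
    { x₁ = 0 ; x₂ = 1 ; ont = [] ; pos = position-body ; fo = compile (sentence g n) }

  con-closed : ∀ {n x} (cs : Vec Const n) → ¬ (x inTerms map con cs)
  con-closed cs (j , eq) with () ← trans (sym (lookup-map j con cs)) eq

  rule-PLDL : ∀ g n → PLDL V (rule g n)
  rule-PLDL g n = record
    { distinct     = λ ()
    ; ont-nonmeta  = []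
    ; pos-positive = _
    ; pos-atomic   = P-nonmeta , P-nonmeta
    ; fo-atomic    = compile-atoms _ (λ _ _ → P-nonmeta) _ (sentence g n)
    ; x₁-free      = inj₁ (inj₁ refl)
    ; x₂-free      = inj₂ (inj₁ refl)
    ; ont-free     = λ ()
    ; fo-free      = λ free → contradiction (proj₁ (compile-free (sentence g n) free)) λ ()
    ; x₁-ont       = λ ()
    ; x₂-ont       = λ ()
    ; x₁-pos       = ((λ ()) , con-closed args) , ((λ ()) , con-closed args)
    ; x₂-pos       = ((λ ()) , con-closed args) , ((λ ()) , con-closed args)
    ; x₁-fo        = only-identifier 0 (λ _ ())
    ; x₂-fo        = only-identifier 1 (λ _ ())
    }
    where
    only-identifier : ∀ x → (∀ y → x ≢ 2 + y) →
      EveryAtom (OnlyIdentifier V x) (compile (sentence g n))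
    only-identifier x fresh = compile-atoms
      (λ { 0F refl → contradiction refl (fresh 0)
         ; 1F refl → contradiction refl (fresh 1)
         ; 2F refl → contradiction refl (fresh 2) })
      (λ y z → (λ ()) , λ (j , eq) → apart z (trans (sym (lookup-replicate j (var (2 + z)))) eq))
      (λ y z → fresh y , apart z)
      (sentence g n)
      where
      apart : ∀ z → var (2 + z) ≢ var x
      apart z refl = fresh z refl

  rules : Rec 1 → ℕ → RuleSet V
  rules g n = rule g n ∷ [] , rule-PLDL g n ∷ []

  template : Rec 1 → ℕ
  template g = bodyCode (compile {3} (graph g 2F (0F ∷ []) 2F))

  numeral-code : ℕ → ℕ
  numeral-code n = exCode 5 (andCode (bodyCode (equal 5 9)) (bodyCode (numeral n 2)))

  instance-code : ℕ → ℕ → ℕ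
  instance-code t n = ruleSetCode 0 1 (bodyCode position-body)
    (exCode 7 (exCode 8 (andCode (bodyCode (compile axioms))
      (exCode 9 (andCode (numeral-code n) t)))))

  -- The code sees `g` only through the number `template g`; the diagonal argument uses this number
  -- as `n` too.
  code-rules : ∀ g n → codeRuleSet {V} (rules g n) ≡ instance-code (template g) n
  code-rules g n = trans
    (codeRuleSet-singleton V (rules g n) (rule g n) (rule-PLDL g n ∷ []) refl refl)
    (cong (ruleSetCode 0 1 (bodyCode position-body)) code-sentence)
    where
    matrix : Body
    matrix = compile {3} (graph g 2F (0F ∷ []) 2F)
    copy : Body
    copy = equal 5 9 and numeral n 2
    unfolded : compile (sentence g n) ≡ ex 7 (ex 8 (compile axioms and ex 9 (ex 5 copy and matrix)))
    unfolded = refl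
    code-sentence : bodyCode (compile (sentence g n)) ≡
      exCode 7 (exCode 8 (andCode (bodyCode (compile axioms))
        (exCode 9 (andCode (numeral-code n) (bodyCode matrix)))))
    code-sentence = trans (cong bodyCode unfolded) (trans (bodyCode-ex 7 _) (cong (exCode 7)
      (trans (bodyCode-ex 8 _) (cong (exCode 8)
      (trans (bodyCode-and _ _) (cong (andCode _)
      (trans (bodyCode-ex 9 _) (cong (exCode 9)
      (trans (bodyCode-and _ _) (cong (λ c → andCode c (bodyCode matrix))
      (trans (bodyCode-ex 5 _) (cong (exCode 5) (bodyCode-and _ _)))))))))))))

  -- `numeral` reuses variables 5 and 6 at every step, so each code arises from the previous one by
  -- a fixed function.
  numeral-computable : Computable {1} (λ xs → bodyCode (numeral (lookup xs zero) 2))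
  numeral-computable = recursion (λ k → bodyCode (numeral k 2))
    (λ _ r → exCode 6 (andCode (bodyCode (edge 2 1 0))
      (exCode 5 (andCode (bodyCode (equal 5 6)) r))))
    (exCode-computable 6 (andCode-computable (constant (bodyCode (edge 2 1 0)))
      (exCode-computable 5 (andCode-computable (constant (bodyCode (equal 5 6))) (component 1F)))))
    code-suc
    where
    unfolded : ∀ k → numeral (suc k) 2 ≡ ex 6 (edge 2 1 0 and ex 5 (equal 5 6 and numeral k 2))
    unfolded k = refl
    code-suc : ∀ k → bodyCode (numeral (suc k) 2) ≡
      exCode 6 (andCode (bodyCode (edge 2 1 0))
        (exCode 5 (andCode (bodyCode (equal 5 6)) (bodyCode (numeral k 2)))))
    code-suc k = trans (cong bodyCode (unfolded k)) (trans (bodyCode-ex 6 _) (cong (exCode 6)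
      (trans (bodyCode-and _ _) (cong (andCode _)
      (trans (bodyCode-ex 5 _) (cong (exCode 5) (bodyCode-and _ _)))))))

  instance-code-computable : Computable {1} (λ xs → instance-code (lookup xs zero) (lookup xs zero))
  instance-code-computable = ruleSetCode-computable 0 1 (bodyCode position-body)
    (exCode-computable 7 (exCode-computable 8 (andCode-computable
      (constant (bodyCode (compile axioms)))
      (exCode-computable 9 (andCode-computable
        (exCode-computable 5
          (andCode-computable (constant (bodyCode (equal 5 9))) numeral-computable))
        (component 0F))))))

-- Truth of the sentence and the value of the function

sentence-sound : ∀ {E B} → (∀ {a b c} → E a b c → c < B) →
  ∀ g n → ⟦_⟧ E (sentence g n) [] → ¬ ¬ (g [ n ∷ [] ]↦ 0)
sentence-sound {E} {B} bound g n
  (o , p , (no-pred , irrefl , transitive , descending) , x , num-x , γ) κ =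
  sound g (num-x ∷ []) (to (⟦graph⟧ E g refl refl refl) γ)
    λ (v , num-o , g↦v) → κ (subst (g [ _ ]↦_) (numeral-zero num-o) g↦v)
  where
  -- The axioms are negated existentials and make `E p` transitive, and successor steps descending,
  -- only up to double negation. The bound `B` is a decidable condition and is unaffected.
  _≻_ : Const → Const → Set
  a ≻ b = ¬ ¬ E p a b
  wf : WellFounded (E o)
  wf = Subrelation.wellFounded (λ s ¬p → descending (_ , _ , s , ¬p))
    (bounded⇒wellFounded _≻_ (λ x≻x → x≻x λ e → irrefl (_ , e))
      (λ x≻y y≻z ¬xz → x≻y λ e → y≻z λ e′ → transitive (_ , _ , _ , e , e′ , ¬xz))
      B (λ x≻y → decidable-stable (_ <? B) λ y≮B → x≻y (y≮B ∘ bound)))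
  open Soundness {E} {o} (λ e → no-pred (_ , e)) wf

module _ {e : ℕ → Const} (e-injective : ∀ {a b} → e a ≡ e b → a ≡ b) where
  open Completeness e e-injective
  open Model e e-injective

  ev-numeral : ∀ n → Eventually (λ E → Numeral E (e 0) n (e n))
  ev-numeral zero    = ev-always refl
  ev-numeral (suc n) = ev-map (λ (s , ν) → _ , s , ν) (ev-both (ev-successor n) (ev-numeral n))

  axioms-hold : ∀ {E N} → Encodes (E (e 0)) (Successor N) → Encodes (E (e 1)) (Greater N) →
    ⟦_⟧ E axioms (e 1 ∷ e 0 ∷ [])
  axioms-hold {E} {N} (_ , line-out) (order-in , order-out) =
    (λ (c , r) → let _ , _ , (_ , b≡) , _ , 0≡ = line-out r in
      contradiction (trans (e-injective 0≡) b≡) λ ()) ,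
    (λ (c , r) → let _ , _ , (b<a , _) , c≡ , c≡′ = order-out r in
      <-irrefl (e-injective (trans (sym c≡′) c≡)) b<a) ,
    (λ (c , d , f , r , r′ , ¬s) →
      let _ , _ , (b<a , a≤N) , c≡ , d≡ = order-out r
          _ , _ , (h<g , _) , d≡′ , f≡ = order-out r′ in
      ¬s (order c≡ f≡
        (<-≤-trans h<g (≤-trans (≤-reflexive (e-injective (trans (sym d≡′) d≡))) (<⇒≤ b<a)))
        a≤N)) ,
    λ (c , d , r , ¬s) →
      let _ , _ , (a<N , b≡) , c≡ , d≡ = line-out r in
      ¬s (order d≡ c≡ (≤-reflexive (sym b≡)) (≤-trans (≤-reflexive b≡) a<N))
    where
    order : ∀ {a b c d} → c ≡ e a → d ≡ e b → b < a → a ≤ N → E (e 1) c d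
    order refl refl b<a a≤N = order-in (b<a , a≤N)

  sentence-complete : ∀ {g n} → g [ n ∷ [] ]↦ 0 →
    ∃[ ts ] (∀ {E} → Represents E ts → ⟦_⟧ E (sentence g n) [])
  sentence-complete {g} {n} g↦0 =
    let N , hs , holds = ev-both (ev-numeral n) (complete g g↦0)
        ts , spec = model N hs in
    ts , λ {E} rep →
      let met , line-enc , order-enc = spec {E} rep
          num-n , γ = holds met in
      e 0 , e 1 , axioms-hold {E} line-enc order-enc , e n , num-n ,
      from (⟦graph⟧ E g refl refl refl) γ

-- From the sentence to acyclicity

constants : Fact → List Const
constants α = toList (Fact.args α)

module _ (V : MetaVocabulary) {m} (P : Pred (suc m)) (Q : Pred 3) where
  open Compile V P Q

  -- Dataset and meta-database are finite, and an element in the third place occurs in a `Q`-fact or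
  -- in its fact `self`. The third place is where the lower element of the order stands.
  edge-bounded : ∀ {D} T (M : MetaDatabase V D) →
    ∃[ B ] (∀ {a b c} → Edge T M a b c → c < B)
  edge-bounded {D} T M = suc (max 0 cs) ,
    λ (_ , _ , _ , _ , _ , l , q) → s≤s (All.lookup (xs≤max 0 cs) (third (isID 2F) l q))
    where
    open MetaDatabase M
    cs : List Const
    cs = concatMap constants (facts ++ D)
    occurs : ∀ {α c} → α ∈ facts ++ D → c ∈ constants α → c ∈ cs
    occurs α∈ c∈ = ∈-concatMap⁺ constants (lose α∈ c∈)
    third : ∀ b {c d₁ d₂ d₃} → Link T M b c d₃ → fact Q (d₁ ∷ d₂ ∷ d₃ ∷ []) ∈ facts ++ D → c ∈ cs
    third true  (self∈D , _) _ = occurs (∈-++⁺ʳ facts self∈D) (here refl)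
    third false refl         q = occurs q (there (there (here refl)))

module Cycles (V : MetaVocabulary) (T : Theory) {m} (P : Pred (suc m)) (Q : Pred 3)
  (P-nonmeta : ¬ MetaVocabulary.Meta V P) (Q-meta : MetaVocabulary.Meta V Q)
  (args : Vec Const (suc m)) where
  open MetaVocabulary V
  open Compile V P Q
  open Reduction V P Q P-nonmeta args

  -- The first preference of a cycle already makes the sentence true. That `g` yields 0 follows only
  -- doubly negated, which is enough to contradict the hypothesis.
  acyclic : ∀ g n → ¬ (g [ n ∷ [] ]↦ 0) → Acyclic V T (rules g n)
  acyclic g n g↛0 D D-data M α cycle with first cycle
    where
    first : ∀ {α β} → TransClosure (Preferred V T M (proj₁ (rules g n))) α β →
      ∃[ γ ] Preferred V T M (proj₁ (rules g n)) α γ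
    first [ p ]   = _ , p
    first (p ∷ _) = _ , p
  ... | _ , _ , _ , here (ν , _ , _ , _ , _ , fo-true) , _ =
    sentence-sound (proj₂ (edge-bounded V P Q T M)) g n
      (to (compile-true T M (sentence g n) {ν} {[]} λ ()) fo-true) g↛0

  cyclic : ∀ g n {D C} → KBData V D → Conflict D T C → fact P args ∈ C →
    g [ n ∷ [] ]↦ 0 → ¬ Acyclic V T (rules g n)
  cyclic g n {D₀} {C} D₀-data C-conflict α∈C g↦0 no-cycle =
    no-cycle D D-data M (fact P args)
      [ α∈D , α∈D , here condition , C , extended , α∈C , α∈C ]
    where
    ts = proj₁ (sentence-complete (enumerate-injective nonid-infinite) {g} {n} g↦0)
    open Intended V T P-nonmeta Q-meta D₀-data ts
    α∈D : fact P args ∈ D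
    α∈D = ∈-++⁺ˡ (Conflict.subset C-conflict α∈C)
    -- A conflict depends on the dataset only through inclusion, so it survives the added facts.
    extended : Conflict D T C
    extended = record
      { subset       = ∈-++⁺ˡ ∘ Conflict.subset C-conflict
      ; inconsistent = Conflict.inconsistent C-conflict
      ; minimal      = Conflict.minimal C-conflict
      }
    -- The two rule variables need the same value and the sentence is closed, so a constant
    -- valuation suffices.
    ν : Var → Value V
    ν _ = inj₁ (identifier (fact P args))
    identified : ∀ {x} → AtomTrue V T M ν (x ≔id pname P ⟨ map con args ⟩)
    identified = _ , (P , args , refl , sym (map-∘ _ _ args) , refl) , α∈D , refl
    condition : CondTrue V T M (rule g n) (identifier (fact P args)) (identifier (fact P args))
    condition = ν , refl , refl , [] , (identified {0} , identified {1}) ,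
      from (compile-true T M (sentence g n) {ν} {[]} λ ())
        (proj₂ (sentence-complete (enumerate-injective nonid-infinite) {g} {n} g↦0) edge-represents)

-- Diagonalisation

swap : Rec 1
swap = prim (comp succ (zero ∷ [])) (comp zero [])

swap-0 : swap [ 0 ∷ [] ]↦ 1
swap-0 = prim↦₀ (comp↦ (zero↦ ∷ []) succ↦)

swap-1 : swap [ 1 ∷ [] ]↦ 0
swap-1 = prim↦ₛ swap-0 (comp↦ [] zero↦)

theorem3 : (V : MetaVocabulary) (T : Theory) → NonTrivial V T →
    Undecidable (codeRuleSet {V}) (Acyclic V T)
theorem3 V T (D , D-data , C , C-conflict , fact P@(symbol _) args , α∈C) (χ , decides) =
  is-cyclic is-acyclic
  where
  open MetaVocabulary V
  P-nonmeta : ¬ Meta P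
  P-nonmeta = proj₁ (D-data (Conflict.subset C-conflict α∈C))
  Q-choice : ∃[ i ] 0 ≤ i × Meta (symbol {2} i)
  Q-choice = meta-infinite 2 0
  Q : Pred 3
  Q = symbol (proj₁ Q-choice)
  open Reduction V P Q P-nonmeta args
  open Cycles V T P Q P-nonmeta (proj₂ (proj₂ Q-choice)) args
  -- On input `t`, the function asks `χ` about the instance with template `t` and number `t`, and
  -- swaps the answer.
  g : Rec 1
  g = comp swap (comp χ (proj₁ instance-code-computable ∷ []) ∷ [])
  -- The fixed point: instance-code (template g) n is the code of rules g n.
  n : ℕ
  n = template g
  runs : ∀ {v w} → χ [ codeRuleSet {V} (rules g n) ∷ [] ]↦ v → swap [ v ∷ [] ]↦ w → g [ n ∷ [] ]↦ w
  runs χ↦v swap↦w = comp↦ (comp↦ (proj₂ instance-code-computable (n ∷ []) ∷ [])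
    (subst (λ c → χ [ c ∷ [] ]↦ _) (code-rules g n) χ↦v) ∷ []) swap↦w
  -- If the rule set is acyclic, `χ` answers 1 and `g` yields 0 at `n`, which produces a cycle.
  is-cyclic : ¬ Acyclic V T (rules g n)
  is-cyclic Σ-acyclic = cyclic g n D-data C-conflict α∈C
    (runs (proj₁ (decides (rules g n)) Σ-acyclic) swap-1) Σ-acyclic
  -- Since acyclicity is refuted, `χ` answers 0; then `g` yields 1 at `n` and by determinism not 0,
  -- so no cycle exists.
  is-acyclic : Acyclic V T (rules g n)
  is-acyclic = acyclic g n λ g↦0 → contradiction
    (deterministic g (runs (proj₂ (decides (rules g n)) is-cyclic) swap-0) g↦0) λ ()
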